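{- Let $s\in\{\mathtt{0},\mathtt{1}\}^{\mathbb{Z}}$ be a balanced sequence and let $u,v\in\mathcal{L}(s)$ be two factors of $s$. If $u<_{radix}v$, then $\mu_q(u)_{12}\prec\mu_q(v)_{12}$, i.e., $\mu_q(v)_{12}-\mu_q(u)_{12}$ is a nonzero polynomial in the indeterminate $q$ with nonnegative integer coefficients.
   Context: A sequence $s\in\{\mathtt{0},\mathtt{1}\}^{\mathbb{Z}}$ has language $\mathcal{L}(s)=\{s_ks_{k+1}\cdots s_{k+n-1}: k\in\mathbb{Z}, n\ge 0\}$ (its set of factors). $s$ is balanced if for every $n\ge1$, every $u,v\in\mathcal{L}(s)$ of length $n$ and every letter $a\in\{\mathtt{0},\mathtt{1}\}$, the numbers of occurrences of $a$ in $u$ and in $v$ differ by at most $1$. $\mu_q:\{\mathtt{0},\mathtt{1}\}^*\to \mathrm{GL}_2(\mathbb{Z}[q^{\pm1}])$ is the monoid homomorphism with $\mu_q(\mathtt{0})=\begin{pmatrix} q+q^2 & 1\\ q & 1\end{pmatrix}$ and $\mu_q(\mathtt{1})=\begin{pmatrix} q+2q^2+q^3+q^4 & 1+q\\ q+q^2 & 1\end{pmatrix}$; $M_{12}$ denotes the entry in row 1, column 2 of a $2\times 2$ matrix $M$. The radix order: $u<_{radix}v$ if $|u|<|v|$, or $|u|=|v|$ and $u<_{lex}v$ (lexicographic order with $\mathtt{0}<\mathtt{1}$). For $f,g\in\mathbb{Z}[q]$, $f\prec g$ means $f\neq g$ and $g-f\in\mathbb{Z}_{\ge0}[q]$. -}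

module Defs where

open import Data.Nat as ℕ using (ℕ; zero; suc)
open import Data.Integer as ℤ using (ℤ; +_)
open import Data.List using (List; []; _∷_; _++_; length)
open import Data.Product using (Σ; ∃; _×_; _,_)
open import Relation.Binary.PropositionalEquality using (_≡_)
open import Relation.Nullary using (¬_)

data Letter : Set where
  𝟎 𝟏 : Letter

Word : Set
Word = List Letter

Seq : Set
Seq = ℤ → Letter

factorAt : Seq → ℤ → ℕ → Word
factorAt s k zero    = []
factorAt s k (suc n) = s k ∷ factorAt s (k ℤ.+ + 1) n

_∈L_ : Word → Seq → Set
w ∈L s = Σ ℤ λ k → w ≡ factorAt s k (length w)

count : Letter → Word → ℕ
count a [] = 0
count 𝟎 (𝟎 ∷ w) = suc (count 𝟎 w)
count 𝟎 (𝟏 ∷ w) = count 𝟎 w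
count 𝟏 (𝟎 ∷ w) = count 𝟏 w
count 𝟏 (𝟏 ∷ w) = suc (count 𝟏 w)

Balanced : Seq → Set
Balanced s = ∀ (n : ℕ) → 1 ℕ.≤ n → ∀ (u v : Word) → u ∈L s → v ∈L s →
  length u ≡ n → length v ≡ n → ∀ (a : Letter) →
  ℤ.∣ + count a u ℤ.- + count a v ∣ ℕ.≤ 1

data _<lex_ : Word → Word → Set where
  prefix : ∀ {a w} → [] <lex (a ∷ w)
  here   : ∀ {u v} → (𝟎 ∷ u) <lex (𝟏 ∷ v)
  there  : ∀ {a u v} → u <lex v → (a ∷ u) <lex (a ∷ v)

_<radix_ : Word → Word → Set
u <radix v = (length u ℕ.< length v) Data.Sum.⊎ ((length u ≡ length v) × (u <lex v))
  where import Data.Sum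

-- Polynomials in ℤ[q] as coefficient lists (constant term first)
Poly : Set
Poly = List ℤ

coeff : Poly → ℕ → ℤ
coeff []       _       = + 0
coeff (c ∷ f)  zero    = c
coeff (c ∷ f)  (suc n) = coeff f n

_⊕_ : Poly → Poly → Poly
[] ⊕ g = g
(a ∷ f) ⊕ [] = a ∷ f
(a ∷ f) ⊕ (b ∷ g) = (a ℤ.+ b) ∷ (f ⊕ g)

scale : ℤ → Poly → Poly
scale a [] = []
scale a (b ∷ g) = (a ℤ.* b) ∷ scale a g

_⊗_ : Poly → Poly → Poly
[] ⊗ g = []
(a ∷ f) ⊗ g = scale a g ⊕ (+ 0 ∷ (f ⊗ g))

_≺_ : Poly → Poly → Set
f ≺ g = (∀ n → coeff f n ℤ.≤ coeff g n) × (∃ λ n → ¬ (coeff f n ≡ coeff g n))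

record Mat : Set where
  constructor mat
  field
    m11 m12 m21 m22 : Poly
open Mat public

_·_ : Mat → Mat → Mat
mat a b c d · mat e f g h =
  mat ((a ⊗ e) ⊕ (b ⊗ g)) ((a ⊗ f) ⊕ (b ⊗ h))
      ((c ⊗ e) ⊕ (d ⊗ g)) ((c ⊗ f) ⊕ (d ⊗ h))

I₂ : Mat
I₂ = mat (+ 1 ∷ []) [] [] (+ 1 ∷ [])

μ₀ : Mat
μ₀ = mat (+ 0 ∷ + 1 ∷ + 1 ∷ []) (+ 1 ∷ []) (+ 0 ∷ + 1 ∷ []) (+ 1 ∷ [])

μ₁ : Mat
μ₁ = mat (+ 0 ∷ + 1 ∷ + 2 ∷ + 1 ∷ + 1 ∷ []) (+ 1 ∷ + 1 ∷ [])
         (+ 0 ∷ + 1 ∷ + 1 ∷ []) (+ 1 ∷ [])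

μletter : Letter → Mat
μletter 𝟎 = μ₀
μletter 𝟏 = μ₁

μq : Word → Mat
μq []      = I₂
μq (a ∷ w) = μletter a · μq w

{-# OPTIONS --safe #-}
-- Fix a slope p/N and give the prefix of length k of a word w the height
-- h(k) = |prefix|₁ N − k p.  Call w slope-balanced if its heights differ by less
-- than N.  Two factors of length n of a balanced sequence are slope-balanced for a
-- common slope, which can be chosen so that the heights of a word are distinct.
--
-- Raising the lowest height of a slope-balanced word by N keeps it slope-balanced
-- and replaces a factor 01 by 10, or a final 0 by 1.  By such moves one goes up from
-- any factor to any lexicographically larger one of the same length.  In a move from
-- w01w′ to w10w′ the balance of both words forces one of w̃ (the reversal of w) and w′
-- to be a prefix of the other.  Now μ(10) − μ(01) = (1 + q³) J with
-- J = q ((0, 1), (−q, 0)), and μ(a) J μ(a) = det μ(a) J with det μ(a) a power of q, so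
-- μ(w) J μ(w′) collapses to a power of q times μ(z) J or J μ(z), whose (1,2) entry is
-- positive.
--
-- For different lengths, the largest slope-balanced word of length m is 1w and the
-- smallest one of length m + 1 is 0wa, with the same w, and the (1,2) entry increases
-- from 1w to 0wa for every word w.
module Submission where

open import Defs
open import Data.Empty using (⊥; ⊥-elim)
open import Data.Integer as ℤ using (ℤ; +_; -[1+_]; _+_; _*_; -_; _-_; _≤_; _<_; pred; 0ℤ; 1ℤ; +≤+; +<+)
import Data.Integer.Properties as ℤₚ
open import Data.Integer.Tactic.RingSolver using (solve-∀)
open import Data.List using (List; []; _∷_; _++_; _∷ʳ_; length; foldr; foldl; reverse; _ʳ++_; take; map; upTo; cartesianProductWith; initLast; _∷ʳ′_)
open import Data.List.Membership.Propositional using (_∈_)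
open import Data.List.Membership.Propositional.Properties using (∈-cartesianProductWith⁺; ∈-cartesianProductWith⁻; ∈-++⁺ˡ; ∈-++⁺ʳ; ∈-map⁺; ∈-upTo⁺)
open import Data.List.Properties using (ʳ++-defn; reverse-involutive; ++-ʳ++; ++-assoc; ++-identityʳ; length-++)
open import Data.List.Relation.Unary.All as All using (All)
open import Data.Nat as ℕ using (ℕ; zero; suc; z≤n; s≤s)
import Data.Nat.Properties as ℕₚ
open import Data.Product using (Σ; ∃; ∃₂; _×_; _,_; proj₁; proj₂)
open import Data.Rational.Unnormalised as ℚ using (ℚᵘ; mkℚᵘ; ↥_; ↧_; *≤*)
import Data.Rational.Unnormalised.Properties as ℚₚ
open import Data.List.Extrema ℚₚ.≤-totalOrder using (max; xs≤max; ⊥≤max; argmax-all)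
open import Data.Sum using (_⊎_; inj₁; inj₂)
open import Function using (_∘_; id)
open import Relation.Binary.Definitions using (Tri; tri<; tri≈; tri>)
open import Relation.Binary.PropositionalEquality using (_≡_; _≢_; refl; sym; trans; cong; cong₂; subst; subst₂)
open import Relation.Nullary using (¬_; Dec; yes; no)

-- The second column of μ

-- Coefficients are indexed by ℤ so that multiplication by q is precomposition with
-- pred and linear identities hold coefficient by coefficient.
Series : Set
Series = ℤ → ℤ

Vector : Set
Vector = Series × Series

-- `φ (pᵢ k)` is the coefficient at `k` of qⁱφ.
p₁ p₂ p₃ p₄ p₅ p₆ : ℤ → ℤ
p₁ = pred
p₂ = p₁ ∘ pred
p₃ = p₂ ∘ pred
p₄ = p₃ ∘ pred
p₅ = p₄ ∘ pred
p₆ = p₅ ∘ pred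

infix 4 _≈_
_≈_ : Vector → Vector → Set
(φ , ψ) ≈ (φ′ , ψ′) = (∀ k → φ k ≡ φ′ k) × (∀ k → ψ k ≡ ψ′ k)

infixl 6 _⊞_
_⊞_ : Vector → Vector → Vector
(φ , ψ) ⊞ (φ′ , ψ′) = (λ k → φ k + φ′ k) , (λ k → ψ k + ψ′ k)

q·_ : Vector → Vector
q· (φ , ψ) = (λ k → φ (pred k)) , (λ k → ψ (pred k))

-- The matrices μ₀ and μ₁ with 2 q² φ written as a sum.
act : Letter → Vector → Vector
act 𝟎 (φ , ψ) =
  (λ k → φ (pred k) + φ (pred (pred k)) + ψ k) ,
  (λ k → φ (pred k) + ψ k)
act 𝟏 (φ , ψ) =
  (λ k → φ (pred k) + (φ (pred (pred k)) + φ (pred (pred k))) + φ (pred (pred (pred k)))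
       + φ (pred (pred (pred (pred k)))) + ψ k + ψ (pred k)) ,
  (λ k → φ (pred k) + φ (pred (pred k)) + ψ k)

δ : Series
δ (+ zero)  = 1ℤ
δ (+ suc _) = 0ℤ
δ -[1+ _ ]  = 0ℤ

e₁ e₂ : Vector
e₁ = δ , (λ _ → 0ℤ)
e₂ = (λ _ → 0ℤ) , δ

-- This is μ(w)e₂; its coordinates are the (1,2) and (2,2) entries of μ(w).
column : Word → Vector
column = foldr act e₂

-- A word is often cut in two at some position; its left part is then stored
-- reversed, so that the letter next to the cut comes first.
leftAct : Word → Vector → Vector
leftAct A c = foldl (λ d a → act a d) c A

column-ʳ++ : ∀ A B → column (A ʳ++ B) ≡ leftAct A (column B)
column-ʳ++ []      B = refl
column-ʳ++ (a ∷ A) B = column-ʳ++ A (a ∷ B)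

act-cong : ∀ a {c d} → c ≈ d → act a c ≈ act a d
act-cong 𝟎 (f , g) =
  (λ k → cong₂ _+_ (cong₂ _+_ (f _) (f _)) (g k)) ,
  (λ k → cong₂ _+_ (f _) (g k))
act-cong 𝟏 (f , g) =
  (λ k → cong₂ _+_ (cong₂ _+_ (cong₂ _+_ (cong₂ _+_ (cong₂ _+_ (f _) (cong₂ _+_ (f _) (f _))) (f _)) (f _)) (g _)) (g _)) ,
  (λ k → cong₂ _+_ (cong₂ _+_ (f _) (f _)) (g k))

private
  ⊞₂ : ∀ a b a′ b′ → (a + a′) + (b + b′) ≡ (a + b) + (a′ + b′)
  ⊞₂ = solve-∀

  ⊞₃ : ∀ a b c a′ b′ c′ → (a + a′) + (b + b′) + (c + c′) ≡ (a + b + c) + (a′ + b′ + c′)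
  ⊞₃ = solve-∀

  ⊞₇ : ∀ a b c d e f a′ b′ c′ d′ e′ f′ →
       (a + a′) + ((b + b′) + (b + b′)) + (c + c′) + (d + d′) + (e + e′) + (f + f′)
       ≡ (a + (b + b) + c + d + e + f) + (a′ + (b′ + b′) + c′ + d′ + e′ + f′)
  ⊞₇ = solve-∀

act-⊞ : ∀ a c d → act a (c ⊞ d) ≈ act a c ⊞ act a d
act-⊞ 𝟎 (φ , ψ) (φ′ , ψ′) =
  (λ k → ⊞₃ (φ (pred k)) _ (ψ k) (φ′ (pred k)) _ (ψ′ k)) ,
  (λ k → ⊞₂ (φ (pred k)) (ψ k) (φ′ (pred k)) (ψ′ k))
act-⊞ 𝟏 (φ , ψ) (φ′ , ψ′) =
  (λ k → ⊞₇ (φ (p₁ k)) (φ (p₂ k)) (φ (p₃ k)) (φ (p₄ k)) (ψ k) (ψ (p₁ k))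
            (φ′ (p₁ k)) (φ′ (p₂ k)) (φ′ (p₃ k)) (φ′ (p₄ k)) (ψ′ k) (ψ′ (p₁ k))) ,
  (λ k → ⊞₃ (φ (pred k)) _ (ψ k) (φ′ (pred k)) _ (ψ′ k))

-- Definitional: multiplication by q is precomposition with `pred`, and `act a` only combines values
-- at shifted indices.
act-q : ∀ a c → act a (q· c) ≡ q· (act a c)
act-q 𝟎 c = refl
act-q 𝟏 c = refl

≈-trans : ∀ {c d e} → c ≈ d → d ≈ e → c ≈ e
≈-trans (f , g) (f′ , g′) = (λ k → trans (f k) (f′ k)) , (λ k → trans (g k) (g′ k))

leftAct-cong : ∀ A {c d} → c ≈ d → leftAct A c ≈ leftAct A d
leftAct-cong []      c≈d = c≈d
leftAct-cong (a ∷ A) c≈d = leftAct-cong A (act-cong a c≈d)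

leftAct-⊞ : ∀ A c d → leftAct A (c ⊞ d) ≈ leftAct A c ⊞ leftAct A d
leftAct-⊞ []      c d = (λ _ → refl) , (λ _ → refl)
leftAct-⊞ (a ∷ A) c d = ≈-trans {leftAct A (act a (c ⊞ d))} (leftAct-cong A (act-⊞ a c d)) (leftAct-⊞ A (act a c) (act a d))

leftAct-q : ∀ A c → leftAct A (q· c) ≡ q· (leftAct A c)
leftAct-q []      c = refl
leftAct-q (a ∷ A) c = trans (cong (leftAct A) (act-q a c)) (leftAct-q A (act a c))

-- Positivity and the coefficientwise order

NonNeg : Series → Set
NonNeg φ = ∀ k → 0ℤ ≤ φ k

Pos : Series → Set
Pos φ = NonNeg φ × ∃ λ k → 0ℤ < φ k

NonNegᵛ : Vector → Set
NonNegᵛ (φ , ψ) = NonNeg φ × NonNeg ψ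

+-nonNeg : ∀ {i j} → 0ℤ ≤ i → 0ℤ ≤ j → 0ℤ ≤ i + j
+-nonNeg = ℤₚ.+-mono-≤

nonNeg+pos : ∀ {i j} → 0ℤ ≤ i → 0ℤ < j → 0ℤ < i + j
nonNeg+pos = ℤₚ.+-mono-≤-<

pos+nonNeg : ∀ {i j} → 0ℤ < i → 0ℤ ≤ j → 0ℤ < i + j
pos+nonNeg = ℤₚ.+-mono-<-≤

pos-at-suc : ∀ (φ : Series) {k} → 0ℤ < φ k → 0ℤ < φ (pred (ℤ.suc k))
pos-at-suc φ {k} = subst (λ i → 0ℤ < φ i) (sym (ℤₚ.pred-suc k))

NonNeg-δ : NonNeg δ
NonNeg-δ (+ zero)  = +≤+ z≤n
NonNeg-δ (+ suc _) = +≤+ z≤n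
NonNeg-δ -[1+ _ ]  = +≤+ z≤n

0<δ0 : 0ℤ < δ 0ℤ
0<δ0 = +<+ (s≤s z≤n)

act-nonNeg : ∀ a {c} → NonNegᵛ c → NonNegᵛ (act a c)
act-nonNeg 𝟎 (f , g) =
  (λ k → +-nonNeg (+-nonNeg (f _) (f _)) (g k)) ,
  (λ k → +-nonNeg (f _) (g k))
act-nonNeg 𝟏 (f , g) =
  (λ k → +-nonNeg (+-nonNeg (+-nonNeg (+-nonNeg (+-nonNeg (f _) (+-nonNeg (f _) (f _))) (f _)) (f _)) (g _)) (g _)) ,
  (λ k → +-nonNeg (+-nonNeg (f _) (f _)) (g k))

leftAct-nonNeg : ∀ A {c} → NonNegᵛ c → NonNegᵛ (leftAct A c)
leftAct-nonNeg []      c≥0 = c≥0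
leftAct-nonNeg (a ∷ A) c≥0 = leftAct-nonNeg A (act-nonNeg a c≥0)

-- Both (1,1) entries contain the term q, which carries a positive coefficient from k to k + 1.
act-pos₁ : ∀ a {c} → NonNegᵛ c → Pos (proj₁ c) → Pos (proj₁ (act a c))
act-pos₁ 𝟎 {φ , ψ} c≥0@(f , g) (_ , k , 0<φk) =
  proj₁ (act-nonNeg 𝟎 c≥0) , ℤ.suc k ,
  pos+nonNeg (pos+nonNeg (pos-at-suc φ 0<φk) (f _)) (g _)
act-pos₁ 𝟏 {φ , ψ} c≥0@(f , g) (_ , k , 0<φk) =
  proj₁ (act-nonNeg 𝟏 c≥0) , ℤ.suc k ,
  pos+nonNeg (pos+nonNeg (pos+nonNeg (pos+nonNeg (pos+nonNeg (pos-at-suc φ 0<φk)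
    (+-nonNeg (f _) (f _))) (f _)) (f _)) (g _)) (g _)

-- All entries in the second columns of μ(𝟎) and μ(𝟏) have constant term 1, so the index stays the
-- same.
act-pos₂ : ∀ a {c} → NonNegᵛ c → Pos (proj₂ c) → Pos (proj₁ (act a c)) × Pos (proj₂ (act a c))
act-pos₂ 𝟎 c≥0@(f , g) (_ , k , 0<ψk) =
  (proj₁ (act-nonNeg 𝟎 c≥0) , k , nonNeg+pos (+-nonNeg (f _) (f _)) 0<ψk) ,
  (proj₂ (act-nonNeg 𝟎 c≥0) , k , nonNeg+pos (f _) 0<ψk)
act-pos₂ 𝟏 c≥0@(f , g) (_ , k , 0<ψk) =
  (proj₁ (act-nonNeg 𝟏 c≥0) , k , pos+nonNeg (nonNeg+pos (+-nonNeg (+-nonNeg (+-nonNeg (f _) (+-nonNeg (f _) (f _))) (f _)) (f _)) 0<ψk) (g _)) ,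
  (proj₂ (act-nonNeg 𝟏 c≥0) , k , nonNeg+pos (+-nonNeg (f _) (f _)) 0<ψk)

leftAct-pos₁ : ∀ A {c} → NonNegᵛ c → Pos (proj₁ c) → Pos (proj₁ (leftAct A c))
leftAct-pos₁ []      c≥0 φ>0 = φ>0
leftAct-pos₁ (a ∷ A) c≥0 φ>0 = leftAct-pos₁ A (act-nonNeg a c≥0) (act-pos₁ a c≥0 φ>0)

NonNegᵛ-e₂ : NonNegᵛ e₂
NonNegᵛ-e₂ = (λ _ → ℤₚ.≤-refl) , NonNeg-δ

column-nonNeg : ∀ w → NonNegᵛ (column w)
column-nonNeg []      = NonNegᵛ-e₂
column-nonNeg (a ∷ w) = act-nonNeg a (column-nonNeg w)

column-pos₂ : ∀ w → Pos (proj₂ (column w))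
column-pos₂ []      = NonNeg-δ , 0ℤ , 0<δ0
column-pos₂ (a ∷ w) = proj₂ (act-pos₂ a (column-nonNeg w) (column-pos₂ w))

entry : Word → Series
entry w = proj₁ (column w)

Pos-q : ∀ {φ} → Pos φ → Pos (λ k → φ (pred k))
Pos-q {φ} (f , k , p) = (λ k → f (pred k)) , ℤ.suc k , pos-at-suc φ p

Pos-resp : ∀ {φ ψ} → (∀ k → φ k ≡ ψ k) → Pos ψ → Pos φ
Pos-resp e (f , k , p) = (λ k → subst (0ℤ ≤_) (sym (e k)) (f k)) , k , subst (0ℤ <_) (sym (e k)) p

infix 4 _⊰_ _≼_
_≼_ _⊰_ : Series → Series → Set
φ ≼ ψ = ∀ k → φ k ≤ ψ k
φ ⊰ ψ = φ ≼ ψ × ∃ λ k → φ k < ψ k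

⊰-≼-trans : ∀ {φ ψ χ} → φ ⊰ ψ → ψ ≼ χ → φ ⊰ χ
⊰-≼-trans (f , k , p) g = (λ k → ℤₚ.≤-trans (f k) (g k)) , k , ℤₚ.<-≤-trans p (g k)

≼-⊰-trans : ∀ {φ ψ χ} → φ ≼ ψ → ψ ⊰ χ → φ ⊰ χ
≼-⊰-trans f (g , k , p) = (λ k → ℤₚ.≤-trans (f k) (g k)) , k , ℤₚ.≤-<-trans (f k) p

⊰-of-diff : ∀ {φ ψ χ} → (∀ k → ψ k ≡ φ k + χ k) → Pos χ → φ ⊰ ψ
⊰-of-diff {φ} e (f , k , p) =
  (λ k → subst₂ _≤_ (ℤₚ.+-identityʳ (φ k)) (sym (e k)) (ℤₚ.+-monoʳ-≤ (φ k) (f k))) ,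
  k , subst₂ _<_ (ℤₚ.+-identityʳ (φ k)) (sym (e k)) (ℤₚ.+-monoʳ-< (φ k) p)

-- Exchanging adjacent letters

-- μ(𝟏)μ(𝟎) − μ(𝟎)μ(𝟏) = (1 + q³) J, where J c below is the action of q ((0, 1), (−q, 0)).
J : Vector → Vector
J (φ , ψ) = (λ k → ψ (p₁ k)) , (λ k → - φ (p₂ k))

private
  -- In the coefficient identities a subscript i on a variable marks a value at `pᵢ k`, that is, a
  -- factor qⁱ.
  swap₁ : ∀ x₁ x₂ x₃ x₄ x₅ x₆ y₀ y₁ y₂ y₃ y₄ →
      (x₂ + x₃ + y₁) + ((x₃ + x₄ + y₂) + (x₃ + x₄ + y₂)) + (x₄ + x₅ + y₃) + (x₅ + x₆ + y₄) + (x₁ + y₀) + (x₂ + y₁)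
      ≡ ((x₂ + (x₃ + x₃) + x₄ + x₅ + y₁ + y₂) + (x₃ + (x₄ + x₄) + x₅ + x₆ + y₂ + y₃) + (x₁ + x₂ + y₀)) + (y₁ + y₄)
  swap₁ = solve-∀

  swap₂ : ∀ x₁ x₂ x₃ x₄ x₅ y₀ y₁ y₂ →
      (x₂ + x₃ + y₁) + (x₃ + x₄ + y₂) + (x₁ + y₀)
      ≡ ((x₂ + (x₃ + x₃) + x₄ + x₅ + y₁ + y₂) + (x₁ + x₂ + y₀)) + (- x₂ + - x₅)
  swap₂ = solve-∀

act-swap : ∀ c → act 𝟏 (act 𝟎 c) ≈ act 𝟎 (act 𝟏 c) ⊞ (J c ⊞ q· (q· (q· J c)))
act-swap (φ , ψ) =
  (λ k → swap₁ (φ (p₁ k)) (φ (p₂ k)) (φ (p₃ k)) (φ (p₄ k)) (φ (p₅ k)) (φ (p₆ k))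
           (ψ k) (ψ (p₁ k)) (ψ (p₂ k)) (ψ (p₃ k)) (ψ (p₄ k))) ,
  (λ k → swap₂ (φ (p₁ k)) (φ (p₂ k)) (φ (p₃ k)) (φ (p₄ k)) (φ (p₅ k))
           (ψ k) (ψ (p₁ k)) (ψ (p₂ k)))

private
  J₀₁ : ∀ x₃ x₄ y₂ y₃ → (x₃ + y₂) + (x₄ + y₃) + - (x₃ + x₄ + y₂) ≡ y₃
  J₀₁ = solve-∀

  J₀₂ : ∀ x₃ x₄ y₂ → (x₃ + y₂) + - (x₃ + x₄ + y₂) ≡ - x₄
  J₀₂ = solve-∀

  J₁₁ : ∀ x₃ x₄ x₅ x₆ x₇ y₂ y₃ y₄ y₅ →
      (x₃ + x₄ + y₂) + ((x₄ + x₅ + y₃) + (x₄ + x₅ + y₃)) + (x₅ + x₆ + y₄) + (x₆ + x₇ + y₅)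
      + - (x₃ + (x₄ + x₄) + x₅ + x₆ + y₂ + y₃) + - (x₄ + (x₅ + x₅) + x₆ + x₇ + y₃ + y₄) ≡ y₅
  J₁₁ = solve-∀

  J₁₂ : ∀ x₃ x₄ x₅ x₆ y₂ y₃ →
      (x₃ + x₄ + y₂) + (x₄ + x₅ + y₃) + - (x₃ + (x₄ + x₄) + x₅ + x₆ + y₂ + y₃) ≡ - x₆
  J₁₂ = solve-∀

-- The exponents are those of det μ(𝟎) = q² and det μ(𝟏) = q⁴.
act-J₀ : ∀ c → act 𝟎 (J (act 𝟎 c)) ≈ q· (q· J c)
act-J₀ (φ , ψ) =
  (λ k → J₀₁ (φ (p₃ k)) (φ (p₄ k)) (ψ (p₂ k)) (ψ (p₃ k))) ,
  (λ k → J₀₂ (φ (p₃ k)) (φ (p₄ k)) (ψ (p₂ k)))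

act-J₁ : ∀ c → act 𝟏 (J (act 𝟏 c)) ≈ q· (q· (q· (q· J c)))
act-J₁ (φ , ψ) =
  (λ k → J₁₁ (φ (p₃ k)) (φ (p₄ k)) (φ (p₅ k)) (φ (p₆ k)) (φ (p₆ (p₁ k)))
           (ψ (p₂ k)) (ψ (p₃ k)) (ψ (p₄ k)) (ψ (p₅ k))) ,
  (λ k → J₁₂ (φ (p₃ k)) (φ (p₄ k)) (φ (p₅ k)) (φ (p₆ k)) (ψ (p₂ k)) (ψ (p₃ k)))

-- One word is a prefix of the other. With `A` the reversed left part of a cut word and `B` its
-- right part, each `_∷_` is a pair of equal letters placed symmetrically about the cut.
data Comparable : Word → Word → Set where
  []ˡ : ∀ {B} → Comparable [] B
  []ʳ : ∀ {A} → Comparable A []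
  _∷_ : ∀ a {A B} → Comparable A B → Comparable (a ∷ A) (a ∷ B)

-- The vector q e₁ is both J e₂ and μ(𝟏)e₂ - μ(𝟎)e₂, so this serves exchanges as well as a change of
-- the last letter.
leftAct-qe₁-pos : ∀ A → Pos (proj₁ (leftAct A (q· e₁)))
leftAct-qe₁-pos A = leftAct-pos₁ A (NonNeg-δ ∘ pred , λ _ → ℤₚ.≤-refl) (Pos-q (NonNeg-δ , 0ℤ , 0<δ0))

-- Equal letters on the two sides of J cancel to a power of q. When the left side is exhausted, the
-- first coordinate is q times a (2,2) entry; when the right side is, J e₂ = q e₁ remains.
leftAct-J-pos : ∀ {A B} → Comparable A B → Pos (proj₁ (leftAct A (J (column B))))
leftAct-J-pos {B = B} []ˡ = Pos-q (column-pos₂ B)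
leftAct-J-pos {A} []ʳ = leftAct-qe₁-pos A
leftAct-J-pos {_ ∷ A} {_ ∷ B} (𝟎 ∷ c) =
  Pos-resp (proj₁ (leftAct-cong A (act-J₀ (column B))))
    (subst (Pos ∘ proj₁) (sym (trans (leftAct-q A _) (cong q·_ (leftAct-q A _))))
      (Pos-q (Pos-q (leftAct-J-pos c))))
leftAct-J-pos {_ ∷ A} {_ ∷ B} (𝟏 ∷ c) =
  Pos-resp (proj₁ (leftAct-cong A (act-J₁ (column B))))
    (subst (Pos ∘ proj₁) (sym (trans (leftAct-q A _) (cong q·_ (trans (leftAct-q A _)
        (cong q·_ (trans (leftAct-q A _) (cong q·_ (leftAct-q A _))))))))
      (Pos-q (Pos-q (Pos-q (Pos-q (leftAct-J-pos c))))))

Pos-+ : ∀ {φ ψ} → Pos φ → NonNeg ψ → Pos (λ k → φ k + ψ k)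
Pos-+ (f , k , p) g = (λ k → +-nonNeg (f k) (g k)) , k , pos+nonNeg p (g k)

leftAct-⊰ : ∀ A {c c′} d → c′ ≈ c ⊞ d → Pos (proj₁ (leftAct A d)) → proj₁ (leftAct A c) ⊰ proj₁ (leftAct A c′)
leftAct-⊰ A {c} d e = ⊰-of-diff (λ k → trans (proj₁ (leftAct-cong A e) k) (proj₁ (leftAct-⊞ A c d) k))

entry-swap : ∀ {A B} → Comparable A B → entry (A ʳ++ 𝟎 ∷ 𝟏 ∷ B) ⊰ entry (A ʳ++ 𝟏 ∷ 𝟎 ∷ B)
entry-swap {A} {B} c
  rewrite column-ʳ++ A (𝟎 ∷ 𝟏 ∷ B) | column-ʳ++ A (𝟏 ∷ 𝟎 ∷ B) =
  leftAct-⊰ A _ (act-swap (column B))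
    (Pos-resp (proj₁ (leftAct-⊞ A (J (column B)) _))
      (Pos-+ P (proj₁ (subst (Pos ∘ proj₁) (sym (trans (leftAct-q A _) (cong q·_ (trans (leftAct-q A _)
        (cong q·_ (leftAct-q A _)))))) (Pos-q (Pos-q (Pos-q P)))))))
  where P = leftAct-J-pos c

entry-last : ∀ A → entry (A ʳ++ 𝟎 ∷ []) ⊰ entry (A ʳ++ 𝟏 ∷ [])
entry-last A rewrite column-ʳ++ A (𝟎 ∷ []) | column-ʳ++ A (𝟏 ∷ []) =
  leftAct-⊰ A (q· e₁) ((λ _ → refl) , λ _ → sym (ℤₚ.+-identityʳ _)) (leftAct-qe₁-pos A)

-- From 𝟏w to 𝟎wa

_≼ᵛ_ : Vector → Vector → Set
(φ , ψ) ≼ᵛ (φ′ , ψ′) = φ ≼ φ′ × ψ ≼ ψ′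

act-mono : ∀ a {c d} → c ≼ᵛ d → act a c ≼ᵛ act a d
act-mono 𝟎 (f , g) =
  (λ k → ℤₚ.+-mono-≤ (ℤₚ.+-mono-≤ (f _) (f _)) (g k)) ,
  (λ k → ℤₚ.+-mono-≤ (f _) (g k))
act-mono 𝟏 (f , g) =
  (λ k → ℤₚ.+-mono-≤ (ℤₚ.+-mono-≤ (ℤₚ.+-mono-≤ (ℤₚ.+-mono-≤ (ℤₚ.+-mono-≤ (f _)
           (ℤₚ.+-mono-≤ (f _) (f _))) (f _)) (f _)) (g _)) (g _)) ,
  (λ k → ℤₚ.+-mono-≤ (ℤₚ.+-mono-≤ (f _) (f _)) (g k))

column-mono-++ : ∀ w {x y} → column x ≼ᵛ column y → column (w ++ x) ≼ᵛ column (w ++ y)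
column-mono-++ []      x≼y = x≼y
column-mono-++ (a ∷ w) x≼y = act-mono a (column-mono-++ w x≼y)

≤-+ˡ : ∀ {i j k} → 0ℤ ≤ i → j ≤ k → j ≤ i + k
≤-+ˡ {j = j} 0≤i j≤k = subst (_≤ _) (ℤₚ.+-identityˡ j) (ℤₚ.+-mono-≤ 0≤i j≤k)

-- The (2,2) entries of μ(𝟎) and μ(𝟏) are 1 and the other contributions are nonnegative. Hence
-- entries do not decrease when a word is extended to the right.
e₂≼column : ∀ w → e₂ ≼ᵛ column w
e₂≼column []      = (λ _ → ℤₚ.≤-refl) , (λ _ → ℤₚ.≤-refl)
e₂≼column (𝟎 ∷ w) =
  proj₁ (column-nonNeg (𝟎 ∷ w)) ,
  (λ k → ≤-+ˡ (proj₁ (column-nonNeg w) _) (proj₂ (e₂≼column w) k))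
e₂≼column (𝟏 ∷ w) =
  proj₁ (column-nonNeg (𝟏 ∷ w)) ,
  (λ k → ≤-+ˡ (+-nonNeg (proj₁ (column-nonNeg w) _) (proj₁ (column-nonNeg w) _)) (proj₂ (e₂≼column w) k))

column-prefix : ∀ x y → column x ≼ᵛ column (x ++ y)
column-prefix []      y = e₂≼column y
column-prefix (a ∷ x) y = act-mono a (column-prefix x y)

e₁−qe₂ : Vector
e₁−qe₂ = δ , λ k → - δ (p₁ k)

private
  g₀₁ : ∀ d₁ d₂ → d₁ + d₂ + - d₁ ≡ d₂
  g₀₁ = solve-∀

  g₁₁ : ∀ d₁ d₂ d₃ d₄ → d₁ + (d₂ + d₂) + d₃ + d₄ + - d₁ + - d₂ ≡ d₂ + d₃ + d₄
  g₁₁ = solve-∀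

-- A single letter absorbs the negative coordinate: the images under μ(𝟎) and μ(𝟏) are (q², 0) and
-- (q² + q³ + q⁴, q²).
act-e₁−qe₂-nonNeg : ∀ b → NonNegᵛ (act b e₁−qe₂)
act-e₁−qe₂-nonNeg 𝟎 =
  (λ k → subst (0ℤ ≤_) (sym (g₀₁ (δ (p₁ k)) _)) (NonNeg-δ (p₂ k))) ,
  (λ k → subst (0ℤ ≤_) (sym (ℤₚ.+-inverseʳ (δ (p₁ k)))) ℤₚ.≤-refl)
act-e₁−qe₂-nonNeg 𝟏 =
  (λ k → subst (0ℤ ≤_) (sym (g₁₁ (δ (p₁ k)) (δ (p₂ k)) (δ (p₃ k)) (δ (p₄ k))))
           (+-nonNeg (+-nonNeg (NonNeg-δ (p₂ k)) (NonNeg-δ (p₃ k))) (NonNeg-δ (p₄ k)))) ,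
  (λ k → subst (0ℤ ≤_) (sym (g₀₁ (δ (p₁ k)) _)) (NonNeg-δ (p₂ k)))

leftAct-e₁−qe₂-pos : ∀ A → Pos (proj₁ (leftAct A e₁−qe₂))
leftAct-e₁−qe₂-pos []      = NonNeg-δ , 0ℤ , 0<δ0
leftAct-e₁−qe₂-pos (b ∷ A) = leftAct-pos₁ A (act-e₁−qe₂-nonNeg b) (proj₁ (act-e₁−qe₂-nonNeg b) , + 2 , act-g-2 b)
  where
  act-g-2 : ∀ b → 0ℤ < proj₁ (act b e₁−qe₂) (+ 2)
  act-g-2 𝟎 = +<+ (s≤s z≤n)
  act-g-2 𝟏 = +<+ (s≤s z≤n)

-- gap b = (q + q²) μ(b)(e₁ − q e₂) − q⁴ μ(b) e₂; for w = w″ b the entry grows from 𝟏w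
-- to 𝟎w𝟎 by the first coordinate of μ(w″) gap b plus the second one of
-- μ(w″) μ(b)(e₁ − q e₂).
gap : Letter → Vector
gap 𝟎 = q· (q· (q· e₁−qe₂))
gap 𝟏 = (λ k → δ (p₃ k) + δ (p₄ k) + δ (p₅ k) + δ (p₆ k)) , (λ k → δ (p₃ k))

-- `gap 𝟎` is q³(e₁ - q e₂), handled by the previous lemma although its second coordinate is
-- negative; `gap 𝟏` is nonnegative, with leading witness q³.
leftAct-gap-pos : ∀ b A → Pos (proj₁ (leftAct A (gap b)))
leftAct-gap-pos 𝟎 A =
  subst (Pos ∘ proj₁) (sym (trans (leftAct-q A _) (cong q·_ (trans (leftAct-q A _) (cong q·_ (leftAct-q A _))))))
    (Pos-q (Pos-q (Pos-q (leftAct-e₁−qe₂-pos A))))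
leftAct-gap-pos 𝟏 A =
  leftAct-pos₁ A (nn , (λ k → NonNeg-δ _)) (nn , + 3 , +<+ (s≤s z≤n))
  where
  nn : NonNeg (proj₁ (gap 𝟏))
  nn k = +-nonNeg (+-nonNeg (+-nonNeg (NonNeg-δ (p₃ k)) (NonNeg-δ (p₄ k))) (NonNeg-δ (p₅ k))) (NonNeg-δ (p₆ k))

private
  split₀₁ : ∀ d₀ d₁ d₂ → (0ℤ + 0ℤ + d₁) + (0ℤ + 0ℤ + d₂) + (0ℤ + d₀)
      ≡ (d₁ + d₂ + - d₁) + ((0ℤ + 0ℤ + d₁) + (0ℤ + 0ℤ + d₀))
  split₀₁ = solve-∀

  split₀₂ : ∀ d₀ d₁ → (0ℤ + 0ℤ + d₁) + (0ℤ + d₀)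
      ≡ (d₁ + - d₁) + ((0ℤ + d₁) + (0ℤ + d₀))
  split₀₂ = solve-∀

  split₁₁ : ∀ d₀ d₁ d₂ d₃ d₄ →
      (0ℤ + 0ℤ + d₁) + ((0ℤ + 0ℤ + d₂) + (0ℤ + 0ℤ + d₂)) + (0ℤ + 0ℤ + d₃) + (0ℤ + 0ℤ + d₄) + (0ℤ + d₀) + (0ℤ + d₁)
      ≡ (d₁ + (d₂ + d₂) + d₃ + d₄ + - d₁ + - d₂)
        + ((0ℤ + (0ℤ + 0ℤ) + 0ℤ + 0ℤ + d₁ + d₂) + (0ℤ + (0ℤ + 0ℤ) + 0ℤ + 0ℤ + d₀ + d₁))
  split₁₁ = solve-∀

-- This is μ(b) applied to μ(𝟎)e₂ = e₁ + e₂ = (e₁ - q e₂) + (1 + q)e₂.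
act-split : ∀ b → act b (act 𝟎 e₂) ≈ act b e₁−qe₂ ⊞ (q· (act b e₂) ⊞ act b e₂)
act-split 𝟎 =
  (λ k → split₀₁ (δ k) (δ (p₁ k)) (δ (p₂ k))) ,
  (λ k → split₀₂ (δ k) (δ (p₁ k)))
act-split 𝟏 =
  (λ k → split₁₁ (δ k) (δ (p₁ k)) (δ (p₂ k)) (δ (p₃ k)) (δ (p₄ k))) ,
  (λ k → split₀₁ (δ k) (δ (p₁ k)) (δ (p₂ k)))

private
  gap₀₁ : ∀ d₂ d₃ d₄ → (d₂ + d₃ + - d₂) + (d₃ + d₄ + - d₃) ≡ d₃ + (0ℤ + 0ℤ + d₄)
  gap₀₁ = solve-∀

  gap₀₂ : ∀ d₂ d₃ d₄ → (d₂ + - d₂) + (d₃ + - d₃) ≡ - d₄ + (0ℤ + d₄)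
  gap₀₂ = solve-∀

  gap₁₁ : ∀ d₂ d₃ d₄ d₅ d₆ →
      (d₂ + (d₃ + d₃) + d₄ + d₅ + - d₂ + - d₃) + (d₃ + (d₄ + d₄) + d₅ + d₆ + - d₃ + - d₄)
      ≡ (d₃ + d₄ + d₅ + d₆) + (0ℤ + (0ℤ + 0ℤ) + 0ℤ + 0ℤ + d₄ + d₅)
  gap₁₁ = solve-∀

act-gap : ∀ b → q· (act b e₁−qe₂) ⊞ q· (q· (act b e₁−qe₂)) ≈ gap b ⊞ q· (q· (q· (q· (act b e₂))))
act-gap 𝟎 =
  (λ k → gap₀₁ (δ (p₂ k)) (δ (p₃ k)) (δ (p₄ k))) ,
  (λ k → gap₀₂ (δ (p₂ k)) (δ (p₃ k)) (δ (p₄ k)))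
act-gap 𝟏 =
  (λ k → gap₁₁ (δ (p₂ k)) (δ (p₃ k)) (δ (p₄ k)) (δ (p₅ k)) (δ (p₆ k))) ,
  (λ k → gap₀₁ (δ (p₂ k)) (δ (p₃ k)) (δ (p₄ k)))

⊞-cong : ∀ {c c′ d d′} → c ≈ c′ → d ≈ d′ → c ⊞ d ≈ c′ ⊞ d′
⊞-cong (f , g) (f′ , g′) = (λ k → cong₂ _+_ (f k) (f′ k)) , (λ k → cong₂ _+_ (g k) (g′ k))

≈-reflexive : ∀ {c d} → c ≡ d → c ≈ d
≈-reflexive refl = (λ _ → refl) , (λ _ → refl)

≈-sym : ∀ {c d} → c ≈ d → d ≈ c
≈-sym (f , g) = (λ k → sym (f k)) , (λ k → sym (g k))

leftAct-split : ∀ A b → leftAct A (act b (act 𝟎 e₂)) ≈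
  leftAct A (act b e₁−qe₂) ⊞ (q· leftAct A (act b e₂) ⊞ leftAct A (act b e₂))
leftAct-split A b =
  ≈-trans (leftAct-cong A (act-split b))
  (≈-trans (leftAct-⊞ A (act b e₁−qe₂) _)
  (⊞-cong {leftAct A (act b e₁−qe₂)} (≈-reflexive refl)
  (≈-trans (leftAct-⊞ A (q· act b e₂) _)
  (⊞-cong (≈-reflexive (leftAct-q A (act b e₂))) (≈-reflexive refl)))))

leftAct-gap : ∀ A b → q· leftAct A (act b e₁−qe₂) ⊞ q· (q· leftAct A (act b e₁−qe₂)) ≈
  leftAct A (gap b) ⊞ q· (q· (q· (q· leftAct A (act b e₂))))
leftAct-gap A b =
  ≈-trans (≈-sym (⊞-cong (≈-reflexive (leftAct-q A w))
    (≈-reflexive (trans (leftAct-q A (q· w)) (cong q·_ (leftAct-q A w))))))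
  (≈-trans (≈-sym (leftAct-⊞ A (q· w) (q· (q· w))))
  (≈-trans (leftAct-cong A (act-gap b))
  (≈-trans (leftAct-⊞ A (gap b) _)
  (⊞-cong {leftAct A (gap b)} (≈-reflexive refl)
  (≈-reflexive (trans (leftAct-q A (q· (q· (q· y)))) (cong q·_ (trans (leftAct-q A (q· (q· y)))
    (cong q·_ (trans (leftAct-q A (q· y)) (cong q·_ (leftAct-q A y))))))))))))
  where
  w = act b e₁−qe₂
  y = act b e₂

private
  cross₁ : ∀ w₁ w₂ u y₁ y₂ y₃ z₀ z₁ →
      (w₁ + (y₂ + y₁)) + (w₂ + (y₃ + y₂)) + (u + (z₁ + z₀))
      ≡ (w₁ + w₂) + ((y₁ + (y₂ + y₂) + y₃ + z₀ + z₁) + u)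
  cross₁ = solve-∀

  cross₂ : ∀ v u y₁ y₂ y₃ y₄ z₀ z₁ →
      (v + y₄) + ((y₁ + (y₂ + y₂) + y₃ + z₀ + z₁) + u)
      ≡ (y₁ + (y₂ + y₂) + y₃ + y₄ + z₀ + z₁) + (v + u)
  cross₂ = solve-∀

  cross₀ : ∀ d₀ d₁ d₂ → (0ℤ + 0ℤ + d₁) + (0ℤ + 0ℤ + d₂) + (0ℤ + d₀)
      ≡ (0ℤ + (0ℤ + 0ℤ) + 0ℤ + 0ℤ + d₀ + d₁) + d₂
  cross₀ = solve-∀

-- By `leftAct-split` the first row (q + q², 1) of μ(𝟎) meets (1 + q)y, and (q + q²)(1 + q) = q +
-- 2q² + q³ falls short of the (1,1) entry of μ(𝟏) only by q⁴. The term (q + q²)w compensates for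
-- q⁴y, leaving `gap`.
cross : ∀ A → proj₁ (act 𝟏 (leftAct A e₂)) ⊰ proj₁ (act 𝟎 (leftAct A (act 𝟎 e₂)))
cross [] = ⊰-of-diff (λ k → cross₀ (δ k) (δ (p₁ k)) (δ (p₂ k))) (Pos-q (Pos-q (NonNeg-δ , 0ℤ , 0<δ0)))
cross (b ∷ A) = ⊰-of-diff eq (Pos-+ (leftAct-gap-pos b A) (proj₂ (leftAct-nonNeg A (act-e₁−qe₂-nonNeg b))))
  where
  y = leftAct A (act b e₂)
  w = leftAct A (act b e₁−qe₂)
  v = leftAct A (gap b)
  z = leftAct A (act b (act 𝟎 e₂))
  eq : ∀ k → proj₁ (act 𝟎 z) k ≡ proj₁ (act 𝟏 y) k + (proj₁ v k + proj₂ w k)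
  eq k =
    trans (cong₂ _+_ (cong₂ _+_ (proj₁ (leftAct-split A b) (p₁ k)) (proj₁ (leftAct-split A b) (p₂ k)))
                     (proj₂ (leftAct-split A b) k))
    (trans (cross₁ (proj₁ w (p₁ k)) (proj₁ w (p₂ k)) (proj₂ w k)
              (proj₁ y (p₁ k)) (proj₁ y (p₂ k)) (proj₁ y (p₃ k)) (proj₂ y k) (proj₂ y (p₁ k)))
    (trans (cong₂ _+_ (proj₁ (leftAct-gap A b) k) refl)
           (cross₂ (proj₁ v k) (proj₂ w k) (proj₁ y (p₁ k)) (proj₁ y (p₂ k)) (proj₁ y (p₃ k)) (proj₁ y (p₄ k))
              (proj₂ y k) (proj₂ y (p₁ k)))))

entry-cross : ∀ w a → entry (𝟏 ∷ w) ⊰ entry (𝟎 ∷ w ∷ʳ a)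
entry-cross w a = ⊰-≼-trans
  (subst₂ (λ c d → proj₁ (act 𝟏 c) ⊰ proj₁ (act 𝟎 d)) (eq [] (++-identityʳ w)) (eq (𝟎 ∷ []) refl) (cross (reverse w)))
  last
  where
  eq : ∀ B {x} → w ++ B ≡ x → leftAct (reverse w) (column B) ≡ column x
  eq B e = trans (sym (column-ʳ++ (reverse w) B))
    (cong column (trans (ʳ++-defn (reverse w)) (trans (cong (_++ B) (reverse-involutive w)) e)))
  -- `cross` treats the last letter 𝟎, which gives the smallest entry.
  last : entry (𝟎 ∷ w ∷ʳ 𝟎) ≼ entry (𝟎 ∷ w ∷ʳ a)
  last = proj₁ (column-mono-++ (𝟎 ∷ w) (0≼ a))
    where
    0≼ : ∀ a → column (𝟎 ∷ []) ≼ᵛ column (a ∷ [])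
    0≼ 𝟎 = (λ _ → ℤₚ.≤-refl) , (λ _ → ℤₚ.≤-refl)
    0≼ 𝟏 = proj₁ (entry-last []) , λ k → ℤₚ.≤-refl

-- Comparison with coefficient lists

⟦_⟧ : Poly → Series
⟦ f ⟧ (+ n)    = coeff f n
⟦ f ⟧ -[1+ _ ] = 0ℤ

⟦⊕⟧ : ∀ f g k → ⟦ f ⊕ g ⟧ k ≡ ⟦ f ⟧ k + ⟦ g ⟧ k
⟦⊕⟧ f g -[1+ n ] = refl
⟦⊕⟧ [] g (+ n) = sym (ℤₚ.+-identityˡ _)
⟦⊕⟧ (a ∷ f) [] (+ n) = sym (ℤₚ.+-identityʳ _)
⟦⊕⟧ (a ∷ f) (b ∷ g) (+ zero) = refl
⟦⊕⟧ (a ∷ f) (b ∷ g) (+ suc n) = ⟦⊕⟧ f g (+ n)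

⟦scale⟧ : ∀ a g k → ⟦ scale a g ⟧ k ≡ a * ⟦ g ⟧ k
⟦scale⟧ a g -[1+ n ] = sym (ℤₚ.*-zeroʳ a)
⟦scale⟧ a [] (+ n) = sym (ℤₚ.*-zeroʳ a)
⟦scale⟧ a (b ∷ g) (+ zero) = refl
⟦scale⟧ a (b ∷ g) (+ suc n) = ⟦scale⟧ a g (+ n)

⟦0∷⟧ : ∀ f k → ⟦ 0ℤ ∷ f ⟧ k ≡ ⟦ f ⟧ (pred k)
⟦0∷⟧ f -[1+ n ] = refl
⟦0∷⟧ f (+ zero) = refl
⟦0∷⟧ f (+ suc n) = refl

infixr 7 _⋆_
-- Only the left factor remains a list, so a concrete one unfolds to a linear combination of shifts,
-- the form in which `act` is written.
_⋆_ : Poly → Series → Series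
([] ⋆ φ) k = 0ℤ
((a ∷ f) ⋆ φ) k = a * φ k + (f ⋆ φ) (pred k)

⟦⊗⟧ : ∀ f g k → ⟦ f ⊗ g ⟧ k ≡ (f ⋆ ⟦ g ⟧) k
⟦⊗⟧ [] g -[1+ n ] = refl
⟦⊗⟧ [] g (+ n) = refl
⟦⊗⟧ (a ∷ f) g k = trans (⟦⊕⟧ (scale a g) _ k) (cong₂ _+_ (⟦scale⟧ a g k) (trans (⟦0∷⟧ (f ⊗ g) k) (⟦⊗⟧ f g (pred k))))

⋆-cong : ∀ f {φ ψ} → (∀ k → φ k ≡ ψ k) → ∀ k → (f ⋆ φ) k ≡ (f ⋆ ψ) k
⋆-cong [] e k = refl
⋆-cong (a ∷ f) e k = cong₂ _+_ (cong (a *_) (e k)) (⋆-cong f e (pred k))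

⟦⊗⊕⊗⟧ : ∀ f g {m m′ φ ψ} → (∀ k → ⟦ m ⟧ k ≡ φ k) → (∀ k → ⟦ m′ ⟧ k ≡ ψ k) →
  ∀ k → ⟦ (f ⊗ m) ⊕ (g ⊗ m′) ⟧ k ≡ (f ⋆ φ) k + (g ⋆ ψ) k
⟦⊗⊕⊗⟧ f g {m} {m′} e e′ k = trans (⟦⊕⟧ (f ⊗ m) (g ⊗ m′) k)
  (cong₂ _+_ (trans (⟦⊗⟧ f m k) (⋆-cong f e k)) (trans (⟦⊗⟧ g m′ k) (⋆-cong g e′ k)))

private
  μ₀₁ : ∀ x₀ x₁ x₂ y₀ → (0ℤ * x₀ + (1ℤ * x₁ + (1ℤ * x₂ + 0ℤ))) + (1ℤ * y₀ + 0ℤ) ≡ x₁ + x₂ + y₀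
  μ₀₁ = solve-∀

  μ₀₂ : ∀ x₀ x₁ y₀ → (0ℤ * x₀ + (1ℤ * x₁ + 0ℤ)) + (1ℤ * y₀ + 0ℤ) ≡ x₁ + y₀
  μ₀₂ = solve-∀

  μ₁₁ : ∀ x₀ x₁ x₂ x₃ x₄ y₀ y₁ →
    (0ℤ * x₀ + (1ℤ * x₁ + (+ 2 * x₂ + (1ℤ * x₃ + (1ℤ * x₄ + 0ℤ))))) + (1ℤ * y₀ + (1ℤ * y₁ + 0ℤ))
    ≡ x₁ + (x₂ + x₂) + x₃ + x₄ + y₀ + y₁
  μ₁₁ = solve-∀

⟦μq⟧ : ∀ w → (⟦ m12 (μq w) ⟧ , ⟦ m22 (μq w) ⟧) ≈ column w
⟦μq⟧ [] = zero-series , one-series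
  where
  zero-series : ∀ k → ⟦ [] ⟧ k ≡ 0ℤ
  zero-series (+ n)    = refl
  zero-series -[1+ n ] = refl
  one-series : ∀ k → ⟦ 1ℤ ∷ [] ⟧ k ≡ δ k
  one-series (+ zero)  = refl
  one-series (+ suc n) = refl
  one-series -[1+ n ]  = refl
⟦μq⟧ (𝟎 ∷ w) with column w | ⟦μq⟧ w
... | φ , ψ | e , e′ =
  (λ k → trans (⟦⊗⊕⊗⟧ (m11 μ₀) (m12 μ₀) e e′ k) (μ₀₁ (φ k) (φ (p₁ k)) (φ (p₂ k)) (ψ k))) ,
  (λ k → trans (⟦⊗⊕⊗⟧ (m21 μ₀) (m22 μ₀) e e′ k) (μ₀₂ (φ k) (φ (p₁ k)) (ψ k)))
⟦μq⟧ (𝟏 ∷ w) with column w | ⟦μq⟧ w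
... | φ , ψ | e , e′ =
  (λ k → trans (⟦⊗⊕⊗⟧ (m11 μ₁) (m12 μ₁) e e′ k)
           (μ₁₁ (φ k) (φ (p₁ k)) (φ (p₂ k)) (φ (p₃ k)) (φ (p₄ k)) (ψ k) (ψ (p₁ k)))) ,
  (λ k → trans (⟦⊗⊕⊗⟧ (m21 μ₁) (m22 μ₁) e e′ k) (μ₀₁ (φ k) (φ (p₁ k)) (φ (p₂ k)) (ψ k)))

≺-of-⊰ : ∀ u v → entry u ⊰ entry v → m12 (μq u) ≺ m12 (μq v)
≺-of-⊰ u v (le , k , lt) = (λ n → le′ (+ n)) , witness k lt′
  where
  le′ : ⟦ m12 (μq u) ⟧ ≼ ⟦ m12 (μq v) ⟧
  le′ k = subst₂ _≤_ (sym (proj₁ (⟦μq⟧ u) k)) (sym (proj₁ (⟦μq⟧ v) k)) (le k)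
  lt′ : ⟦ m12 (μq u) ⟧ k < ⟦ m12 (μq v) ⟧ k
  lt′ = subst₂ _<_ (sym (proj₁ (⟦μq⟧ u) k)) (sym (proj₁ (⟦μq⟧ v) k)) lt
  witness : ∀ k → ⟦ m12 (μq u) ⟧ k < ⟦ m12 (μq v) ⟧ k → ∃ λ n → ¬ (coeff (m12 (μq u)) n ≡ coeff (m12 (μq v)) n)
  witness (+ n)    lt = n , λ e → ℤₚ.<-irrefl e lt
  witness -[1+ n ] lt = ⊥-elim (ℤₚ.<-irrefl refl lt)

-- Slope-balanced words

private
  move-lhs : ∀ a c → a + (c - a) ≡ c
  move-lhs = solve-∀

  move-rhs : ∀ {a b c d} → b - a ≡ d - c → b + (c - a) ≡ d
  move-rhs {a} {b} {c} {d} e = trans (regroup a b c) (trans (cong (_+ c) e) (cancel c d))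
    where
    regroup : ∀ a b c → b + (c - a) ≡ (b - a) + c
    regroup = solve-∀
    cancel : ∀ c d → (d - c) + c ≡ d
    cancel = solve-∀

-- With these, linear inequalities reduce to ring identities between differences.
move-< : ∀ {a b c d} → a < b → b - a ≡ d - c → c < d
move-< {a} {b} {c} {d} a<b e = subst₂ _<_ (move-lhs a c) (move-rhs {a} {b} {c} {d} e) (ℤₚ.+-monoˡ-< (c - a) a<b)

move-≤ : ∀ {a b c d} → a ≤ b → b - a ≡ d - c → c ≤ d
move-≤ {a} {b} {c} {d} a≤b e = subst₂ _≤_ (move-lhs a c) (move-rhs {a} {b} {c} {d} e) (ℤₚ.+-monoˡ-≤ (c - a) a≤b)

-- Prefix counts and moves

ones : Word → ℕ → ℕ
ones w k = count 𝟏 (take k w)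

argmin : ∀ (h : ℕ → ℤ) m → ∃ λ i → i ℕ.≤ m × (∀ k → k ℕ.≤ m → h i ≤ h k)
argmin h zero = 0 , z≤n , λ { zero z≤n → ℤₚ.≤-refl }
argmin h (suc m) with argmin h m
... | i , i≤m , min with ℤₚ.≤-total (h i) (h (suc m))
...   | inj₁ le = i , ℕₚ.m≤n⇒m≤1+n i≤m , min′
  where
  min′ : ∀ k → k ℕ.≤ suc m → h i ≤ h k
  min′ k k≤ with ℕₚ.m≤n⇒m<n∨m≡n k≤
  ... | inj₁ (s≤s k≤m) = min k k≤m
  ... | inj₂ refl      = le
...   | inj₂ ge = suc m , ℕₚ.≤-refl , min′
  where
  min′ : ∀ k → k ℕ.≤ suc m → h (suc m) ≤ h k
  min′ k k≤ with ℕₚ.m≤n⇒m<n∨m≡n k≤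
  ... | inj₁ (s≤s k≤m) = ℤₚ.≤-trans ge (min k k≤m)
  ... | inj₂ refl      = ℤₚ.≤-refl

-- A move lifts the height at `i` by N and keeps the others; in terms of `ones` this does not
-- mention the slope.
record Raise (i : ℕ) (x x′ : Word) : Set where
  field
    length≡ : length x′ ≡ length x
    at      : ones x′ i ≡ suc (ones x i)
    off     : ∀ k → k ℕ.≤ length x → k ≢ i → ones x′ k ≡ ones x k

cons-Raise : ∀ a {i x x′} → Raise i x x′ → Raise (suc i) (a ∷ x) (a ∷ x′)
cons-Raise a {i} {x} {x′} r = record { length≡ = cong suc length≡ ; at = at′ a ; off = off′ a }
  where
  open Raise r
  at′ : ∀ a → ones (a ∷ x′) (suc i) ≡ suc (ones (a ∷ x) (suc i))
  at′ 𝟎 = at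
  at′ 𝟏 = cong suc at
  off′ : ∀ a k → k ℕ.≤ suc (length x) → k ≢ suc i → ones (a ∷ x′) k ≡ ones (a ∷ x) k
  off′ a zero    _         _ = refl
  off′ 𝟎 (suc k) (s≤s k≤) k≢ = off k k≤ (k≢ ∘ cong suc)
  off′ 𝟏 (suc k) (s≤s k≤) k≢ = cong suc (off k k≤ (k≢ ∘ cong suc))

Raise-swap : ∀ α β → Raise (suc (length α)) (α ++ 𝟎 ∷ 𝟏 ∷ β) (α ++ 𝟏 ∷ 𝟎 ∷ β)
Raise-swap (a ∷ α) β = cons-Raise a (Raise-swap α β)
Raise-swap []      β = record { length≡ = refl ; at = refl ; off = off }
  where
  off : ∀ k → k ℕ.≤ 2 ℕ.+ length β → k ≢ 1 → ones (𝟏 ∷ 𝟎 ∷ β) k ≡ ones (𝟎 ∷ 𝟏 ∷ β) k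
  off zero          _ _  = refl
  off (suc zero)    _ k≢ = ⊥-elim (k≢ refl)
  off (suc (suc k)) _ _  = refl

Raise-last : ∀ α → Raise (suc (length α)) (α ++ 𝟎 ∷ []) (α ++ 𝟏 ∷ [])
Raise-last (a ∷ α) = cons-Raise a (Raise-last α)
Raise-last []      = record { length≡ = refl ; at = refl ; off = off }
  where
  off : ∀ k → k ℕ.≤ 1 → k ≢ 1 → ones (𝟏 ∷ []) k ≡ ones (𝟎 ∷ []) k
  off zero       _ _  = refl
  off (suc zero) _ k≢ = ⊥-elim (k≢ refl)
  off (suc (suc k)) (s≤s ()) _

-- Termination measure: every move lowers it by one.
deficit : Word → ℕ
deficit []      = 0
deficit (𝟎 ∷ w) = suc (length w) ℕ.+ deficit w
deficit (𝟏 ∷ w) = deficit w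

deficit-cons : ∀ a {x x′} → length x′ ≡ length x → deficit x ≡ suc (deficit x′) → deficit (a ∷ x) ≡ suc (deficit (a ∷ x′))
deficit-cons 𝟎 {x} {x′} l e = trans (cong₂ (λ m n → suc m ℕ.+ n) (sym l) e) (ℕₚ.+-suc (suc (length x′)) (deficit x′))
deficit-cons 𝟏 l e = e

deficit-swap : ∀ α β → deficit (α ++ 𝟎 ∷ 𝟏 ∷ β) ≡ suc (deficit (α ++ 𝟏 ∷ 𝟎 ∷ β))
deficit-swap []      β = refl
deficit-swap (a ∷ α) β = deficit-cons a (Raise.length≡ (Raise-swap α β)) (deficit-swap α β)

deficit-last : ∀ α → deficit (α ++ 𝟎 ∷ []) ≡ suc (deficit (α ++ 𝟏 ∷ []))
deficit-last []      = refl
deficit-last (a ∷ α) = deficit-cons a (Raise.length≡ (Raise-last α)) (deficit-last α)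

ones-injective : ∀ x y → length x ≡ length y → (∀ k → k ℕ.≤ length x → ones x k ≡ ones y k) → x ≡ y
ones-injective []      []      _ _ = refl
ones-injective (𝟎 ∷ x) (𝟎 ∷ y) l e = cong (𝟎 ∷_) (ones-injective x y (ℕₚ.suc-injective l) (λ k k≤ → e (suc k) (s≤s k≤)))
ones-injective (𝟏 ∷ x) (𝟏 ∷ y) l e =
  cong (𝟏 ∷_) (ones-injective x y (ℕₚ.suc-injective l) (λ k k≤ → ℕₚ.suc-injective (e (suc k) (s≤s k≤))))
ones-injective (𝟎 ∷ x) (𝟏 ∷ y) l e with () ← e 1 (s≤s z≤n)
ones-injective (𝟏 ∷ x) (𝟎 ∷ y) l e with () ← e 1 (s≤s z≤n)

split : ∀ (x : Word) {j} → j ℕ.< length x → ∃ λ α → ∃₂ λ a β → x ≡ α ++ a ∷ β × length α ≡ j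
split (a ∷ x) {zero}  _        = [] , a , x , refl , refl
split (a ∷ x) {suc j} (s≤s j<) with split x j<
... | α , b , β , refl , refl = a ∷ α , b , β , refl , refl

compare : ∀ A B → Comparable A B ⊎
  (∃ λ y → ∃₂ λ z z′ → (A ≡ y ++ 𝟎 ∷ z × B ≡ y ++ 𝟏 ∷ z′) ⊎ (A ≡ y ++ 𝟏 ∷ z × B ≡ y ++ 𝟎 ∷ z′))
compare []      B       = inj₁ []ˡ
compare (_ ∷ _) []      = inj₁ []ʳ
compare (𝟎 ∷ A) (𝟏 ∷ B) = inj₂ ([] , A , B , inj₁ (refl , refl))
compare (𝟏 ∷ A) (𝟎 ∷ B) = inj₂ ([] , A , B , inj₂ (refl , refl))
compare (𝟎 ∷ A) (𝟎 ∷ B) with compare A B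
... | inj₁ c = inj₁ (𝟎 ∷ c)
... | inj₂ (y , z , z′ , inj₁ (refl , refl)) = inj₂ (𝟎 ∷ y , z , z′ , inj₁ (refl , refl))
... | inj₂ (y , z , z′ , inj₂ (refl , refl)) = inj₂ (𝟎 ∷ y , z , z′ , inj₂ (refl , refl))
compare (𝟏 ∷ A) (𝟏 ∷ B) with compare A B
... | inj₁ c = inj₁ (𝟏 ∷ c)
... | inj₂ (y , z , z′ , inj₁ (refl , refl)) = inj₂ (𝟏 ∷ y , z , z′ , inj₁ (refl , refl))
... | inj₂ (y , z , z′ , inj₂ (refl , refl)) = inj₂ (𝟏 ∷ y , z , z′ , inj₂ (refl , refl))

reverse-ʳ++ : ∀ (α w : Word) → reverse α ʳ++ w ≡ α ++ w
reverse-ʳ++ α w = trans (ʳ++-defn (reverse α)) (cong (_++ w) (reverse-involutive α))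

-- Isolates the adjacent factors aỹa and byb around the cut, where ỹ is the reversal of `y`.
mirror-shape : ∀ (y z : Word) a b (z′ : Word) → (y ++ a ∷ z) ʳ++ (a ∷ b ∷ (y ++ b ∷ z′))
  ≡ reverse z ++ (a ∷ (y ʳ++ (a ∷ []))) ++ (b ∷ (y ++ b ∷ [])) ++ z′
mirror-shape y z a b z′ =
  trans (++-ʳ++ y)
  (trans (ʳ++-defn z)
  (cong (λ w → reverse z ++ a ∷ w)
    (trans (ʳ++-defn y)
    (trans (cong (λ w → reverse y ++ a ∷ b ∷ w) (sym (++-assoc y (b ∷ []) z′)))
    (trans (sym (++-assoc (reverse y) (a ∷ []) _))
    (cong (_++ (b ∷ (y ++ b ∷ []) ++ z′)) (sym (ʳ++-defn y))))))))

infix 4 _⊑_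
-- For words of equal length this compares the heights pointwise, whatever the slope; moves ascend
-- in this order.
_⊑_ : Word → Word → Set
x ⊑ y = ∀ k → k ℕ.≤ length x → ones x k ℕ.≤ ones y k

-- Heights relative to a slope

record Slope (n : ℕ) : Set where
  field
    N p     : ℤ
    0<p     : 0ℤ < p
    p<N     : p < N
    -- The heights of the prefixes of a word of length at most n are distinct.
    generic : ∀ c m → m ℕ.< n → c * N ≢ + suc m * p

module Heights {n} (slope : Slope n) where
  open Slope slope

  0<N : 0ℤ < N
  0<N = ℤₚ.<-trans 0<p p<N

  step : Letter → ℤ
  step 𝟎 = - p
  step 𝟏 = N - p

  height : Word → ℕ → ℤ
  height w k = + ones w k * N - + k * p

  total : Word → ℤ
  total []      = 0ℤ
  total (a ∷ w) = step a + total w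

  SlopeBalanced : Word → Set
  SlopeBalanced x = ∀ j k → j ℕ.≤ length x → k ℕ.≤ length x → height x j < height x k + N

  private
    zero-lemma : ∀ N p → 0ℤ * N - 0ℤ * p ≡ 0ℤ
    zero-lemma = solve-∀

    cons₀ : ∀ N p c k → c * N - (1ℤ + k) * p ≡ - p + (c * N - k * p)
    cons₀ = solve-∀

    cons₁ : ∀ N p c k → (1ℤ + c) * N - (1ℤ + k) * p ≡ (N - p) + (c * N - k * p)
    cons₁ = solve-∀

  height-0 : ∀ w → height w 0 ≡ 0ℤ
  height-0 w = zero-lemma N p

  height-∷ : ∀ a w k → height (a ∷ w) (suc k) ≡ step a + height w k
  height-∷ 𝟎 w k = cons₀ N p (+ ones w k) (+ k)
  height-∷ 𝟏 w k = cons₁ N p (+ ones w k) (+ k)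

  height-++ : ∀ α w k → height (α ++ w) (length α ℕ.+ k) ≡ total α + height w k
  height-++ []      w k = sym (ℤₚ.+-identityˡ _)
  height-++ (a ∷ α) w k =
    trans (height-∷ a (α ++ w) (length α ℕ.+ k))
    (trans (cong (λ t → step a + t) (height-++ α w k)) (sym (ℤₚ.+-assoc (step a) (total α) (height w k))))

  height-++₀ : ∀ α w → height (α ++ w) (length α) ≡ total α
  height-++₀ α w = trans (cong (height (α ++ w)) (sym (ℕₚ.+-identityʳ (length α))))
    (trans (height-++ α w 0) (trans (cong (λ t → total α + t) (height-0 w)) (ℤₚ.+-identityʳ (total α))))

  total-++ : ∀ α w → total (α ++ w) ≡ total α + total w
  total-++ []      w = sym (ℤₚ.+-identityˡ _)
  total-++ (a ∷ α) w = trans (cong (λ t → step a + t) (total-++ α w)) (sym (ℤₚ.+-assoc (step a) (total α) (total w)))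

  total-ʳ++ : ∀ A B → total (A ʳ++ B) ≡ total A + total B
  total-ʳ++ []      B = sym (ℤₚ.+-identityˡ _)
  total-ʳ++ (a ∷ A) B = trans (total-ʳ++ A (a ∷ B)) (shuffle (total A) (step a) (total B))
    where
    shuffle : ∀ A a B → A + (a + B) ≡ a + A + B
    shuffle = solve-∀

  module _ {α β γ : Word} (sb : SlopeBalanced (α ++ β ++ γ)) where
    private
      x = α ++ β ++ γ

      end : height x (length (α ++ β)) ≡ total α + total β
      end = trans (cong (λ w → height w (length (α ++ β))) (sym (++-assoc α β γ)))
              (trans (height-++₀ (α ++ β) γ) (total-++ α β))

      |αβ|≤ : length (α ++ β) ℕ.≤ length x
      |αβ|≤ = subst (length (α ++ β) ℕ.≤_)
        (trans (sym (length-++ (α ++ β))) (cong length (++-assoc α β γ))) (ℕₚ.m≤m+n _ (length γ))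

      |α|≤ : length α ℕ.≤ length x
      |α|≤ = subst (length α ℕ.≤_) (sym (length-++ α)) (ℕₚ.m≤m+n _ _)

    -- `total β` is the difference of the heights at the two ends of the factor `β`.
    factor<N : total β < N
    factor<N = move-< (subst₂ (λ i j → i < j + N) end (height-++₀ α (β ++ γ)) (sb _ _ |αβ|≤ |α|≤)) (eq (total α) (total β) N)
      where
      eq : ∀ a b N → (a + N) - (a + b) ≡ N - b
      eq = solve-∀

    factor>-N : 0ℤ < total β + N
    factor>-N = move-< (subst₂ (λ i j → i < j + N) (height-++₀ α (β ++ γ)) end (sb _ _ |α|≤ |αβ|≤)) (eq (total α) (total β) N)
      where
      eq : ∀ a b N → (a + b + N) - a ≡ (b + N) - 0ℤ
      eq = solve-∀

  -- The factors aỹa and byb have the same length and differ by two ones, so their totals differ by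
  -- 2N, yet both lie strictly between -N and N.
  no-mirror : ∀ y z a b z′ → a ≢ b → ¬ SlopeBalanced ((y ++ a ∷ z) ʳ++ (a ∷ b ∷ (y ++ b ∷ z′)))
  no-mirror y z a b z′ a≢b sb =
    contra a b a≢b (subst (_< N) t₁ (factor<N {α} {β₁} sb₁)) (subst (λ t → 0ℤ < t + N) t₁ (factor>-N {α} {β₁} sb₁))
                     (subst (_< N) t₂ (factor<N {α ++ β₁} {β₂} sb₂)) (subst (λ t → 0ℤ < t + N) t₂ (factor>-N {α ++ β₁} {β₂} sb₂))
    where
    α = reverse z
    β₁ = a ∷ (y ʳ++ (a ∷ []))
    β₂ = b ∷ (y ++ b ∷ [])
    sb₁ : SlopeBalanced (α ++ β₁ ++ β₂ ++ z′)
    sb₁ = subst SlopeBalanced (mirror-shape y z a b z′) sb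
    sb₂ : SlopeBalanced ((α ++ β₁) ++ β₂ ++ z′)
    sb₂ = subst SlopeBalanced (sym (++-assoc α β₁ (β₂ ++ z′))) sb₁
    t₁ : total β₁ ≡ step a + (total y + (step a + 0ℤ))
    t₁ = cong (λ t → step a + t) (total-ʳ++ y (a ∷ []))
    t₂ : total β₂ ≡ step b + (total y + (step b + 0ℤ))
    t₂ = cong (λ t → step b + t) (total-++ y (b ∷ []))
    eq₁ : ∀ N p Y → (N + (- p + (Y + (- p + 0ℤ)) + N)) - ((N - p) + (Y + ((N - p) + 0ℤ)) + 0ℤ) ≡ 0ℤ - 0ℤ
    eq₁ = solve-∀
    contra : ∀ a b → a ≢ b → (step a + (total y + (step a + 0ℤ))) < N → 0ℤ < (step a + (total y + (step a + 0ℤ))) + N →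
             (step b + (total y + (step b + 0ℤ))) < N → 0ℤ < (step b + (total y + (step b + 0ℤ))) + N → ⊥
    contra 𝟎 𝟏 _ _ l u _ = ℤₚ.<-irrefl refl (move-< {c = 0ℤ} {0ℤ} (ℤₚ.+-mono-< u l) (eq₁ N p (total y)))
    contra 𝟏 𝟎 _ u _ _ l = ℤₚ.<-irrefl refl (move-< {c = 0ℤ} {0ℤ} (ℤₚ.+-mono-< u l) (eq₁ N p (total y)))
    contra 𝟎 𝟎 a≢b _ _ _ _ = a≢b refl
    contra 𝟏 𝟏 a≢b _ _ _ _ = a≢b refl

  -- A first mismatch of `A` and `B` puts 𝟎ỹ𝟎𝟏y𝟏 into the word before the move or 𝟏ỹ𝟏𝟎y𝟎 into the
  -- word after it; each balance hypothesis excludes one of these.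
  entry-swap-balanced : ∀ A B → SlopeBalanced (A ʳ++ 𝟎 ∷ 𝟏 ∷ B) → SlopeBalanced (A ʳ++ 𝟏 ∷ 𝟎 ∷ B) →
    entry (A ʳ++ 𝟎 ∷ 𝟏 ∷ B) ⊰ entry (A ʳ++ 𝟏 ∷ 𝟎 ∷ B)
  entry-swap-balanced A B sb sb′ with compare A B
  ... | inj₁ c = entry-swap c
  ... | inj₂ (y , z , z′ , inj₁ (refl , refl)) = ⊥-elim (no-mirror y z 𝟎 𝟏 z′ (λ ()) sb)
  ... | inj₂ (y , z , z′ , inj₂ (refl , refl)) = ⊥-elim (no-mirror y z 𝟏 𝟎 z′ (λ ()) sb′)

  private
    suc-height : ∀ N p c k → (1ℤ + c) * N - k * p ≡ (c * N - k * p) + N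
    suc-height = solve-∀

    distinct-eq : ∀ N p c d k m → (c - d) * N ≡ ((c * N - (k + m) * p) - (d * N - k * p)) + m * p
    distinct-eq = solve-∀

  height-suc : ∀ x y k → ones y k ≡ suc (ones x k) → height y k ≡ height x k + N
  height-suc x y k e = trans (cong (λ c → + c * N - + k * p) e) (suc-height N p (+ ones x k) (+ k))

  height-cong : ∀ x y k → ones x k ≡ ones y k → height x k ≡ height y k
  height-cong x y k = cong (λ c → + c * N - + k * p)

  height-gap : ∀ x y k → ones x k ℕ.< ones y k → height x k + N ≤ height y k
  height-gap x y k lt =
    subst (_≤ height y k) (suc-height N p (+ ones x k) (+ k))
      (ℤₚ.+-monoˡ-≤ (- (+ k * p)) (ℤₚ.*-monoʳ-≤-nonNeg N ⦃ ℤ.nonNegative (ℤₚ.<⇒≤ 0<N) ⦄ (+≤+ lt)))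

  -- Equal heights would make (k - j)p a multiple of N.
  height-distinct : ∀ x {j k} → j ℕ.< k → k ℕ.≤ n → height x j ≢ height x k
  height-distinct x {j} {k} j<k k≤n e = generic (+ ones x k - + ones x j) m m<n (trans
      (distinct-eq N p (+ ones x k) (+ ones x j) (+ j) (+ suc m))
      (trans (cong (λ t → (t - height x j) + + suc m * p)
               (trans (cong (λ i → + ones x k * N - + i * p) (sym k≡j+m)) (sym e)))
             (cancel (height x j) (+ suc m * p))))
    where
    m = k ℕ.∸ suc j
    k≡j+m : k ≡ j ℕ.+ suc m
    k≡j+m = trans (sym (ℕₚ.m+[n∸m]≡n j<k)) (sym (ℕₚ.+-suc j m))
    m<n : m ℕ.< n
    m<n = ℕₚ.<-≤-trans (ℕₚ.∸-monoʳ-< {k} {suc j} {0} (s≤s z≤n) j<k) k≤n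
    cancel : ∀ h t → (h - h) + t ≡ t
    cancel = solve-∀

  strict-min : ∀ x {i} → length x ℕ.≤ n → i ℕ.≤ length x → (∀ k → k ℕ.≤ length x → height x i ≤ height x k) →
    ∀ k → k ℕ.≤ length x → k ≢ i → height x i < height x k
  strict-min x {i} x≤n i≤ min k k≤ k≢i = ℤₚ.≤∧≢⇒< (min k k≤) distinct
    where
    distinct : height x i ≢ height x k
    distinct with ℕₚ.<-cmp i k
    ... | tri< i<k _ _ = height-distinct x i<k (ℕₚ.≤-trans k≤ x≤n)
    ... | tri≈ _ i≡k _ = ⊥-elim (k≢i (sym i≡k))
    ... | tri> _ _ k<i = height-distinct x k<i (ℕₚ.≤-trans i≤ x≤n) ∘ sym

  -- The new height h(i) + N stays below every other h(k) + N because h(i) was strictly lowest.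
  Raise-balanced : ∀ {x x′ i} → Raise i x x′ → i ℕ.≤ length x →
    (∀ k → k ℕ.≤ length x → k ≢ i → height x i < height x k) → SlopeBalanced x → SlopeBalanced x′
  Raise-balanced {x} {x′} {i} r i≤ min sb j k j≤ k≤ = go (j ℕ.≟ i) (k ℕ.≟ i)
    where
    open Raise r
    j≤′ = subst (j ℕ.≤_) length≡ j≤
    k≤′ = subst (k ℕ.≤_) length≡ k≤
    at-i : height x′ i ≡ height x i + N
    at-i = height-suc x x′ i at
    off-i : ∀ {l} → l ℕ.≤ length x → l ≢ i → height x′ l ≡ height x l
    off-i {l} l≤ l≢ = height-cong x′ x l (off l l≤ l≢)
    below : ∀ h → h < h + N
    below h = subst (_< h + N) (ℤₚ.+-identityʳ h) (ℤₚ.+-monoʳ-< h 0<N)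
    go : Dec (j ≡ i) → Dec (k ≡ i) → height x′ j < height x′ k + N
    go (yes refl) (yes refl) = below _
    go (yes refl) (no k≢) = subst₂ (λ s t → s < t + N) (sym at-i) (sym (off-i k≤′ k≢)) (ℤₚ.+-monoˡ-< N (min k k≤′ k≢))
    go (no j≢) (yes refl) = subst₂ (λ s t → s < t + N) (sym (off-i j≤′ j≢)) (sym at-i)
      (ℤₚ.<-trans (sb j i j≤′ i≤) (below _))
    go (no j≢) (no k≢) = subst₂ (λ s t → s < t + N) (sym (off-i j≤′ j≢)) (sym (off-i k≤′ k≢)) (sb j k j≤′ k≤′)

  private
    not-𝟏 : ∀ t N p → t - (t + (N - p)) ≡ p - N
    not-𝟏 = solve-∀

    not-𝟎 : ∀ t p → (t + (- p + - p)) - (t + - p) ≡ 0ℤ - p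
    not-𝟎 = solve-∀

  record Next (i : ℕ) (x : Word) : Set where
    field
      {next}   : Word
      raise    : Raise i x next
      deficit≡ : deficit x ≡ suc (deficit next)
      increase : SlopeBalanced x → SlopeBalanced next → entry x ⊰ entry next

  height-++₁ : ∀ α a w → height (α ++ a ∷ w) (suc (length α)) ≡ total α + step a
  height-++₁ α a w = trans (cong (height (α ++ a ∷ w)) (ℕₚ.+-comm 1 (length α)))
    (trans (height-++ α (a ∷ w) 1) (cong (λ t → total α + t)
      (trans (height-∷ a w 0) (trans (cong (λ t → step a + t) (height-0 w)) (ℤₚ.+-identityʳ (step a))))))

  height-++₂ : ∀ α a b w → height (α ++ a ∷ b ∷ w) (suc (suc (length α))) ≡ total α + (step a + step b)
  height-++₂ α a b w = trans (cong (height (α ++ a ∷ b ∷ w)) (ℕₚ.+-comm 2 (length α)))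
    (trans (height-++ α (a ∷ b ∷ w) 2) (cong (λ t → total α + t)
      (trans (height-∷ a (b ∷ w) 1) (cong (λ t → step a + t) (trans (height-++₁ [] b w) (ℤₚ.+-identityˡ (step b)))))))

  -- A letter 𝟏 raises the height by N - p > 0 and 𝟎 lowers it by p > 0. Hence a lowest height comes
  -- after a 𝟎 and is followed by a 𝟏 or by the end of the word.
  next-at : ∀ α a β → (∀ k → k ℕ.≤ length (α ++ a ∷ β) → height (α ++ a ∷ β) (suc (length α)) ≤ height (α ++ a ∷ β) k) →
    Next (suc (length α)) (α ++ a ∷ β)
  next-at α 𝟏 β min = ⊥-elim (ℤₚ.<⇒≱ p<N
    (move-≤ (subst₂ _≤_ (height-++₁ α 𝟏 β) (height-++₀ α (𝟏 ∷ β)) (min (length α) |α|≤)) (not-𝟏 (total α) N p)))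
    where
    |α|≤ = subst (length α ℕ.≤_) (sym (length-++ α)) (ℕₚ.m≤m+n _ _)
  next-at α 𝟎 [] min = record
    { raise    = Raise-last α
    ; deficit≡ = deficit-last α
    ; increase = λ _ _ → subst₂ (λ x y → entry x ⊰ entry y) (reverse-ʳ++ α _) (reverse-ʳ++ α _) (entry-last (reverse α))
    }
  next-at α 𝟎 (𝟏 ∷ β) min = record
    { raise    = Raise-swap α β
    ; deficit≡ = deficit-swap α β
    ; increase = λ sb sb′ → subst₂ (λ x y → entry x ⊰ entry y) (reverse-ʳ++ α _) (reverse-ʳ++ α _)
        (entry-swap-balanced (reverse α) β
          (subst SlopeBalanced (sym (reverse-ʳ++ α _)) sb) (subst SlopeBalanced (sym (reverse-ʳ++ α _)) sb′))
    }
  next-at α 𝟎 (𝟎 ∷ β) min = ⊥-elim (ℤₚ.<⇒≱ 0<p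
    (move-≤ (subst₂ _≤_ (height-++₁ α 𝟎 (𝟎 ∷ β)) (height-++₂ α 𝟎 𝟎 β) (min (2 ℕ.+ length α) |α|≤)) (not-𝟎 (total α) p)))
    where
    |α|≤ : 2 ℕ.+ length α ℕ.≤ length (α ++ 𝟎 ∷ 𝟎 ∷ β)
    |α|≤ = subst₂ ℕ._≤_ (ℕₚ.+-comm (length α) 2) (sym (length-++ α)) (ℕₚ.+-monoʳ-≤ (length α) (s≤s (s≤s z≤n)))

  next-word : ∀ x j → suc j ℕ.≤ length x → (∀ k → k ℕ.≤ length x → height x (suc j) ≤ height x k) → Next (suc j) x
  next-word x j j< min with split x j<
  ... | α , a , β , refl , refl = next-at α a β min

  -- Induction on the deficit: the lowest height of `x` is raised as long as `y` is higher there,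
  -- and the raised word is still below `y`.
  ascend : ∀ fuel x y → deficit x ≡ fuel → length x ≡ length y → length x ℕ.≤ n →
    SlopeBalanced x → SlopeBalanced y → x ⊑ y → x ≡ y ⊎ entry x ⊰ entry y
  ascend fuel x y d≡ len x≤n sbx sby x⊑y with argmin (height x) (length x)
  ... | i , i≤ , min with ones x i ℕ.<? ones y i
  ...   | no i≮ = inj₁ (ones-injective x y len λ k k≤ → ℕₚ.≤-antisym (x⊑y k k≤) (ℕₚ.≮⇒≥ (contra k k≤)))
    where
    ones≡ : ones x i ≡ ones y i
    ones≡ = ℕₚ.≤-antisym (x⊑y i i≤) (ℕₚ.≮⇒≥ i≮)
    -- As `x` and `y` agree where `x` is lowest, an excess of `y` at `k` would put the heights of
    -- `y` at `k` and `i` at least N apart.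
    contra : ∀ k → k ℕ.≤ length x → ¬ (ones x k ℕ.< ones y k)
    contra k k≤ lt = ℤₚ.<⇒≱ (sby k i (subst (k ℕ.≤_) len k≤) (subst (i ℕ.≤_) len i≤))
      (subst (λ t → t + N ≤ height y k) (height-cong x y i ones≡)
        (ℤₚ.≤-trans (ℤₚ.+-monoˡ-≤ N (min k k≤)) (height-gap x y k lt)))
  ascend fuel x y d≡ len x≤n sbx sby x⊑y | zero , i≤ , min | yes ()
  ascend fuel x y d≡ len x≤n sbx sby x⊑y | suc j , i≤ , min | yes lt = continue fuel d≡
    where
    open Next (next-word x j i≤ min) renaming (next to x′)
    open Raise raise
    sbx′ : SlopeBalanced x′
    sbx′ = Raise-balanced raise i≤ (strict-min x x≤n i≤ min) sbx
    x′⊑y : x′ ⊑ y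
    x′⊑y k k≤ with k ℕ.≟ suc j
    ... | yes refl = subst (ℕ._≤ ones y k) (sym at) lt
    ... | no k≢    = subst (ℕ._≤ ones y k) (sym (off k k≤′ k≢)) (x⊑y k k≤′)
      where k≤′ = subst (k ℕ.≤_) length≡ k≤
    continue : ∀ fuel → deficit x ≡ fuel → x ≡ y ⊎ entry x ⊰ entry y
    continue zero    d≡ with () ← trans (sym deficit≡) d≡
    continue (suc f) d≡ with ascend f x′ y (ℕₚ.suc-injective (trans (sym deficit≡) d≡)) (trans length≡ len)
                                (subst (ℕ._≤ n) (sym length≡) x≤n) sbx′ sby x′⊑y
    ... | inj₁ refl = inj₂ (increase sbx sbx′)
    ... | inj₂ x′⊰y = inj₂ (⊰-≼-trans (increase sbx sbx′) (proj₁ x′⊰y))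

-- Lexicographic order and consecutive lengths

lex-ones : ∀ {u v} → u <lex v → length u ≡ length v → ∃ λ j → j ℕ.≤ length u × ones u j ℕ.< ones v j
lex-ones here _ = 1 , s≤s z≤n , s≤s z≤n
lex-ones (there {𝟎} lt) l with lex-ones lt (ℕₚ.suc-injective l)
... | j , j≤ , o = suc j , s≤s j≤ , o
lex-ones (there {𝟏} lt) l with lex-ones lt (ℕₚ.suc-injective l)
... | j , j≤ , o = suc j , s≤s j≤ , s≤s o

ones-++ : ∀ w z k → k ℕ.≤ length w → ones (w ++ z) k ≡ ones w k
ones-++ w       z zero    _        = refl
ones-++ (𝟎 ∷ w) z (suc k) (s≤s k≤) = ones-++ w z k k≤
ones-++ (𝟏 ∷ w) z (suc k) (s≤s k≤) = cong suc (ones-++ w z k k≤)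

module _ {n} (slope : Slope n) where
  open Slope slope
  open Heights slope

  -- If `v` leads at `j` and `u` leads at `k`, each by at least N, then the height changes between
  -- `j` and `k` in the two words differ by at least 2N, while each is less than N in absolute
  -- value.
  lex⇒⊑ : ∀ {u v} → u <lex v → length u ≡ length v → SlopeBalanced u → SlopeBalanced v → u ⊑ v
  lex⇒⊑ {u} {v} u<v l sbu sbv k k≤ with lex-ones u<v l
  ... | j , j≤ , o = ℕₚ.≮⇒≥ λ lt →
    ℤₚ.<-irrefl refl (ℤₚ.<-≤-trans
      (ℤₚ.+-mono-< (sbu k j k≤ j≤) (sbv j k (subst (j ℕ.≤_) l j≤) (subst (k ℕ.≤_) l k≤)))
      (subst (_≤ height u k + height v j) (ℤₚ.+-comm (height v k + N) (height u j + N))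
        (ℤₚ.+-mono-≤ (height-gap v u k lt) (height-gap u v j o))))

  lex⇒⊰ : ∀ {u v} → u <lex v → length u ≡ length v → length u ℕ.≤ n → SlopeBalanced u → SlopeBalanced v →
    entry u ⊰ entry v
  lex⇒⊰ {u} {v} u<v l u≤n sbu sbv with ascend _ u v refl l u≤n sbu sbv (lex⇒⊑ u<v l sbu sbv)
  ... | inj₂ u⊰v = u⊰v
  ... | inj₁ refl with lex-ones u<v l
  ...   | j , _ , o = ⊥-elim (ℕₚ.<-irrefl refl o)

  private
    at-0 : ∀ w {h} → 0ℤ ≤ h → h < N → 0ℤ ≤ h + height w 0 × h + height w 0 < N
    at-0 w {h} 0≤h h<N = subst (0ℤ ≤_) (sym eq) 0≤h , subst (_< N) (sym eq) h<N
      where eq = trans (cong (λ t → h + t) (height-0 w)) (ℤₚ.+-identityʳ h)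
    at-suc : ∀ a w h k → 0ℤ ≤ (h + step a) + height w k × (h + step a) + height w k < N →
      0ℤ ≤ h + height (a ∷ w) (suc k) × h + height (a ∷ w) (suc k) < N
    at-suc a w h k = subst (λ t → 0ℤ ≤ t × t < N)
      (trans (ℤₚ.+-assoc h (step a) (height w k)) (cong (λ t → h + t) (sym (height-∷ a w k))))

    up : ∀ h N p → N - (h + (N - p)) ≡ p - h
    up = solve-∀
    down : ∀ h p → h - p ≡ (h - p) - 0ℤ
    down = solve-∀
    down< : ∀ h p N → (N + p) - (h + 0ℤ) ≡ N - (h - p)
    down< = solve-∀
    up≤ : ∀ h p N → (N + h) - (p + 0ℤ) ≡ (h + (N - p)) - 0ℤ
    up≤ = solve-∀

  -- The greedy walk, with 𝟎 when h ≥ p and 𝟏 otherwise, never leaves [0, N): it codes the rotation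
  -- by -p modulo N.
  window : ∀ m h → 0ℤ ≤ h → h < N →
    ∃ λ w → length w ≡ m × (∀ k → k ℕ.≤ m → 0ℤ ≤ h + height w k × h + height w k < N)
  window zero h 0≤h h<N = [] , refl , λ { zero _ → at-0 [] 0≤h h<N }
  window (suc m) h 0≤h h<N with p ℤ.≤? h
  ... | yes p≤h with window m (h - p) (move-≤ p≤h (down h p)) (move-< (ℤₚ.+-mono-<-≤ h<N (ℤₚ.<⇒≤ 0<p)) (down< h p N))
  ...   | w , l , b = 𝟎 ∷ w , cong suc l ,
          λ { zero _ → at-0 (𝟎 ∷ w) 0≤h h<N ; (suc k) (s≤s k≤) → at-suc 𝟎 w h k (b k k≤) }
  window (suc m) h 0≤h h<N | no p≰h with window m (h + (N - p)) (move-≤ (ℤₚ.+-mono-≤ (ℤₚ.<⇒≤ p<N) 0≤h) (up≤ h p N))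
                                          (move-< (ℤₚ.≰⇒> p≰h) (sym (up h N p)))
  ...   | w , l , b = 𝟏 ∷ w , cong suc l ,
          λ { zero _ → at-0 (𝟏 ∷ w) 0≤h h<N ; (suc k) (s≤s k≤) → at-suc 𝟏 w h k (b k k≤) }

  nonNeg-heights : ∀ {x} → (∀ k → k ℕ.≤ length x → 0ℤ ≤ height x k × height x k < N) → SlopeBalanced x
  nonNeg-heights b j k j≤ k≤ = ℤₚ.<-≤-trans (proj₂ (b j j≤)) (≤-+ˡ (proj₁ (b k k≤)) ℤₚ.≤-refl)

  nonPos-heights : ∀ {x} → (∀ k → k ℕ.≤ length x → 0ℤ < height x k + N × height x k ≤ 0ℤ) → SlopeBalanced x
  nonPos-heights b j k j≤ k≤ = ℤₚ.≤-<-trans (proj₂ (b j j≤)) (proj₁ (b k k≤))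

  -- A word exceeding `t` at `k` would have height at least N there, against height 0 at the start.
  -- Nonpositive heights dually give a smallest word.
  ⊑-nonNeg : ∀ u t → length u ≡ length t → SlopeBalanced u → (∀ k → k ℕ.≤ length t → 0ℤ ≤ height t k) → u ⊑ t
  ⊑-nonNeg u t l sb b k k≤ = ℕₚ.≮⇒≥ λ lt →
    ℤₚ.<⇒≱ (sb k 0 k≤ z≤n)
      (ℤₚ.≤-trans (subst (λ h → h + N ≤ height t k + N) (sym (height-0 u)) (ℤₚ.+-monoˡ-≤ N (b k (subst (k ℕ.≤_) l k≤))))
        (height-gap t u k lt))

  nonPos-⊑ : ∀ t v → length t ≡ length v → SlopeBalanced v → (∀ k → k ℕ.≤ length t → height t k ≤ 0ℤ) → t ⊑ v
  nonPos-⊑ t v l sb b k k≤ = ℕₚ.≮⇒≥ λ lt →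
    ℤₚ.<⇒≱ (subst (_< height v k + N) (height-0 v) (sb 0 k z≤n (subst (k ℕ.≤_) l k≤)))
      (ℤₚ.≤-trans (height-gap v t k lt) (b k k≤))

  ascend-≼ : ∀ x y → length x ≡ length y → length x ℕ.≤ n → SlopeBalanced x → SlopeBalanced y → x ⊑ y → entry x ≼ entry y
  ascend-≼ x y l x≤n sbx sby x⊑y with ascend _ x y refl l x≤n sbx sby x⊑y
  ... | inj₁ refl = λ _ → ℤₚ.≤-refl
  ... | inj₂ x⊰y  = proj₁ x⊰y

  private
    window-𝟎 : ∀ N p h → (N - p + h) - 0ℤ ≡ (- p + h + N) - 0ℤ
    window-𝟎 = solve-∀

    window-𝟎< : ∀ N p h → N - (N - p + h) ≡ 0ℤ - (- p + h)
    window-𝟎< = solve-∀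

    generic-eq : ∀ N p c k → (1ℤ + c) * N ≡ (c * N - k * p + N) + k * p
    generic-eq = solve-∀

  -- The entries increase along u, 𝟏w′, 𝟎w′a, v: the heights of 𝟏w′ lie in
  -- [0, N), those of 𝟎w′a in (-N, 0], and `entry-cross` is the middle step.
  shorter⇒⊰ : ∀ u v {m} → length u ≡ suc m → length v ≡ suc (suc m) → suc (suc m) ℕ.≤ n →
    SlopeBalanced u → SlopeBalanced v → entry u ⊰ entry v
  shorter⇒⊰ u v {m} lu lv m<n sbu sbv
    -- N - p is the height after an initial 𝟏; after an initial 𝟎 it is -p, so the same word runs
    -- exactly N lower.
    with window (suc m) (N - p) (move-≤ (ℤₚ.<⇒≤ p<N) (eq₁ N p)) (move-< 0<p (eq₂ N p))
    where
    eq₁ : ∀ N p → N - p ≡ (N - p) - 0ℤ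
    eq₁ = solve-∀
    eq₂ : ∀ N p → p - 0ℤ ≡ N - (N - p)
    eq₂ = solve-∀
  ... | w , lw , b with initLast w
  ...   | w′ ∷ʳ′ a =
    ≼-⊰-trans (ascend-≼ u t⁺ (trans lu (sym lt⁺)) (subst (ℕ._≤ n) (sym lu) (ℕₚ.<⇒≤ m<n)) sbu (nonNeg-heights {t⁺} b⁺)
                (⊑-nonNeg u t⁺ (trans lu (sym lt⁺)) sbu (λ k k≤ → proj₁ (b⁺ k k≤))))
    (⊰-≼-trans (entry-cross w′ a)
              (ascend-≼ t⁻ v (trans lt⁻ (sym lv)) (subst (ℕ._≤ n) (sym lt⁻) m<n) (nonPos-heights {t⁻} b⁻) sbv
                (nonPos-⊑ t⁻ v (trans lt⁻ (sym lv)) sbv (λ k k≤ → proj₂ (b⁻ k k≤)))))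
    where
    t⁺ = 𝟏 ∷ w′
    t⁻ = 𝟎 ∷ w′ ∷ʳ a
    lt⁻ : length t⁻ ≡ suc (suc m)
    lt⁻ = cong suc lw
    lt⁺ : length t⁺ ≡ suc m
    lt⁺ = trans (ℕₚ.+-comm 1 (length w′)) (trans (sym (length-++ w′)) lw)
    |w′|≤ : ∀ {k} → k ℕ.≤ length w′ → k ℕ.≤ suc m
    |w′|≤ {k} k≤ = subst (k ℕ.≤_) lt⁺ (ℕₚ.m≤n⇒m≤1+n k≤)
    b⁺ : ∀ k → k ℕ.≤ length t⁺ → 0ℤ ≤ height t⁺ k × height t⁺ k < N
    b⁺ zero    _        = subst (λ h → 0ℤ ≤ h × h < N) (sym (height-0 t⁺)) (ℤₚ.≤-refl , 0<N)
    b⁺ (suc k) (s≤s k≤) = subst (λ h → 0ℤ ≤ h × h < N)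
      (trans (cong (λ h → N - p + h) (height-cong (w′ ∷ʳ a) w′ k (ones-++ w′ (a ∷ []) k k≤))) (sym (height-∷ 𝟏 w′ k)))
      (b k (|w′|≤ k≤))
    b⁻ : ∀ k → k ℕ.≤ length t⁻ → 0ℤ < height t⁻ k + N × height t⁻ k ≤ 0ℤ
    b⁻ zero    _        = subst (λ h → 0ℤ < h + N × h ≤ 0ℤ) (sym (height-0 t⁻)) (subst (0ℤ <_) (sym (ℤₚ.+-identityˡ N)) 0<N , ℤₚ.≤-refl)
    b⁻ (suc k) (s≤s k≤) = ℤₚ.≤∧≢⇒< above off-0 , ℤₚ.<⇒≤ below
      where
      bk = b k (subst (k ℕ.≤_) lw k≤)
      hk : height t⁻ (suc k) ≡ - p + height (w′ ∷ʳ a) k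
      hk = height-∷ 𝟎 (w′ ∷ʳ a) k
      above : 0ℤ ≤ height t⁻ (suc k) + N
      above = subst (λ h → 0ℤ ≤ h + N) (sym hk) (move-≤ (proj₁ bk) (window-𝟎 N p (height (w′ ∷ʳ a) k)))
      below : height t⁻ (suc k) < 0ℤ
      below = subst (_< 0ℤ) (sym hk) (move-< (proj₂ bk) (window-𝟎< N p (height (w′ ∷ʳ a) k)))
      -- The window only gives height at least -N; genericity excludes equality.
      off-0 : 0ℤ ≢ height t⁻ (suc k) + N
      off-0 e = generic (1ℤ + + ones t⁻ (suc k)) k (ℕₚ.≤-trans (s≤s (subst (k ℕ.≤_) lw k≤)) m<n)
        (trans (generic-eq N p (+ ones t⁻ (suc k)) (+ suc k))
          (trans (cong (_+ + suc k * p) (sym e)) (ℤₚ.+-identityˡ (+ suc k * p))))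

-- A slope for two factors of a balanced sequence

length-factorAt : ∀ s k m → length (factorAt s k m) ≡ m
length-factorAt s k zero    = refl
length-factorAt s k (suc m) = cong suc (length-factorAt s _ m)

factorAt-∈L : ∀ s k m → factorAt s k m ∈L s
factorAt-∈L s k m = k , cong (factorAt s k) (sym (length-factorAt s k m))

factorAt-+ : ∀ s k m m′ → factorAt s k (m ℕ.+ m′) ≡ factorAt s k m ++ factorAt s (k + + m) m′
factorAt-+ s k zero m′ = cong (λ i → factorAt s i m′) (sym (ℤₚ.+-identityʳ k))
factorAt-+ s k (suc m) m′ = cong (s k ∷_) (trans (factorAt-+ s (k + + 1) m m′)
  (cong (λ i → factorAt s (k + + 1) m ++ factorAt s i m′) (ℤₚ.+-assoc k (+ 1) (+ m))))

take-factorAt : ∀ s k {j m} → j ℕ.≤ m → take j (factorAt s k m) ≡ factorAt s k j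
take-factorAt s k z≤n       = refl
take-factorAt s k (s≤s j≤m) = cong (s k ∷_) (take-factorAt s _ j≤m)

count-++ : ∀ u v → count 𝟏 (u ++ v) ≡ count 𝟏 u ℕ.+ count 𝟏 v
count-++ []      v = refl
count-++ (𝟎 ∷ u) v = count-++ u v
count-++ (𝟏 ∷ u) v = cong suc (count-++ u v)

count≤length : ∀ w → count 𝟏 w ℕ.≤ length w
count≤length []      = z≤n
count≤length (𝟎 ∷ w) = ℕₚ.m≤n⇒m≤1+n (count≤length w)
count≤length (𝟏 ∷ w) = s≤s (count≤length w)

module _ (s : Seq) (balanced : Balanced s) where

  C : ℤ → ℕ → ℕ
  C k m = count 𝟏 (factorAt s k m)

  C-+ : ∀ k m m′ → C k (m ℕ.+ m′) ≡ C k m ℕ.+ C (k + + m) m′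
  C-+ k m m′ = trans (cong (count 𝟏) (factorAt-+ s k m m′)) (count-++ (factorAt s k m) _)

  C-balanced : ∀ k l m → C k (suc m) ℕ.≤ suc (C l (suc m))
  C-balanced k l m = ℤₚ.drop‿+≤+ (move-≤ (ℤₚ.≤-trans (i≤∣i∣ (+ C k (suc m) - + C l (suc m))) (+≤+ bal)) (eq (+ C k (suc m)) (+ C l (suc m))))
    where
    bal = balanced (suc m) (s≤s z≤n) (factorAt s k (suc m)) (factorAt s l (suc m)) (factorAt-∈L s k (suc m))
            (factorAt-∈L s l (suc m)) (length-factorAt s k (suc m)) (length-factorAt s l (suc m)) 𝟏
    i≤∣i∣ : ∀ i → i ≤ + ℤ.∣ i ∣
    i≤∣i∣ (+ n)    = ℤₚ.≤-refl
    i≤∣i∣ -[1+ n ] = ℤ.-≤+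
    eq : ∀ a b → 1ℤ - (a - b) ≡ (1ℤ + b) - a
    eq = solve-∀

  -- The factor is cut into `t` blocks of length m + 1, each balanced against the one at `l`.
  blocks-upper : ∀ l m k t → C k (t ℕ.* suc m) ℕ.≤ t ℕ.* suc (C l (suc m))
  blocks-upper l m k zero    = z≤n
  blocks-upper l m k (suc t) = subst (ℕ._≤ suc t ℕ.* suc (C l (suc m))) (sym (C-+ k (suc m) (t ℕ.* suc m)))
    (ℕₚ.+-mono-≤ (C-balanced k l m) (blocks-upper l m _ t))

  blocks-lower : ∀ l m k t → t ℕ.* C l (suc m) ℕ.≤ C k (t ℕ.* suc m) ℕ.+ t
  blocks-lower l m k zero    = z≤n
  blocks-lower l m k (suc t) = subst (suc t ℕ.* C l (suc m) ℕ.≤_) eq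
      (ℕₚ.+-mono-≤ (C-balanced l k m) (blocks-lower l m (k + + suc m) t))
    where
    c₁ = C k (suc m)
    c₂ = C (k + + suc m) (t ℕ.* suc m)
    eq : suc c₁ ℕ.+ (c₂ ℕ.+ t) ≡ C k (suc t ℕ.* suc m) ℕ.+ suc t
    eq = trans (cong suc (sym (ℕₚ.+-assoc c₁ c₂ t))) (trans (sym (ℕₚ.+-suc (c₁ ℕ.+ c₂) t))
      (cong (ℕ._+ suc t) (sym (C-+ k (suc m) (t ℕ.* suc m)))))

  -- Count in two ways the ones of the factor of length (m + 1)(m′ + 1) at k; its
  -- first block has C k (suc m) ones, which makes the inequality strict.
  density : ∀ k m l m′ → suc m′ ℕ.* C k (suc m) ℕ.< suc m ℕ.* suc (C l (suc m′)) ℕ.+ suc m′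
  density k m l m′ = subst (suc m′ ℕ.* C k (suc m) ℕ.<_) (sym (ℕₚ.+-suc _ m′))
      (s≤s (ℕₚ.≤-trans (ℕₚ.+-monoʳ-≤ (C k (suc m)) (blocks-lower k m (k + + suc m) m′))
        (subst (ℕ._≤ suc m ℕ.* suc (C l (suc m′)) ℕ.+ m′) (sym eq) (ℕₚ.+-monoˡ-≤ m′ upper))))
    where
    eq : C k (suc m) ℕ.+ (C (k + + suc m) (m′ ℕ.* suc m) ℕ.+ m′) ≡ C k (suc m′ ℕ.* suc m) ℕ.+ m′
    eq = trans (sym (ℕₚ.+-assoc (C k (suc m)) _ m′)) (cong (ℕ._+ m′) (sym (C-+ k (suc m) (m′ ℕ.* suc m))))
    upper : C k (suc m′ ℕ.* suc m) ℕ.≤ suc m ℕ.* suc (C l (suc m′))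
    upper = subst (λ t → C k t ℕ.≤ suc m ℕ.* suc (C l (suc m′))) (ℕₚ.*-comm (suc m) (suc m′)) (blocks-upper l m′ k (suc m))

  -- The slopes compatible with the factor of length m + 1 at k exceed this bound.
  lower : ℤ → ℕ → ℚᵘ
  lower k m = mkℚᵘ (+ C k (suc m) - 1ℤ) m

  -- Slopes slightly above such an `r` respect the upper bounds (C l (m + 1) + 1)/(m + 1) imposed by
  -- all factors of `s`; denominators are cleared.
  record Admissible (r : ℚᵘ) : Set where
    field
      below-1     : ↥ r < ↧ r
      below-upper : ∀ l m → ↥ r * + suc m < (1ℤ + + C l (suc m)) * ↧ r

  0-admissible : Admissible (mkℚᵘ 0ℤ 0)
  0-admissible = record { below-1 = +<+ (s≤s z≤n) ; below-upper = λ l m → +<+ (s≤s z≤n) }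

  -- `density` says precisely that every lower bound is less than every upper bound.
  lower-admissible : ∀ k m → Admissible (lower k m)
  lower-admissible k m = record
    { below-1     = move-< (+<+ (s≤s (subst (C k (suc m) ℕ.≤_) (length-factorAt s k (suc m)) (count≤length (factorAt s k (suc m))))))
                      (eq₁ (+ C k (suc m)) (+ suc m))
    ; below-upper = λ l m′ → move-< (subst₂ _<_ (ℤₚ.pos-* (suc m′) (C k (suc m)))
                      (cong (_+ + suc m′) (ℤₚ.pos-* (suc m) (suc (C l (suc m′))))) (+<+ (density k m l m′)))
                      (eq₂ (+ C k (suc m)) (+ suc m) (+ C l (suc m′)) (+ suc m′))
    }
    where
    eq₁ : ∀ c m → (1ℤ + m) - c ≡ m - (c - 1ℤ)
    eq₁ = solve-∀
    eq₂ : ∀ c m c′ m′ → (m * (1ℤ + c′) + m′) - m′ * c ≡ (1ℤ + c′) * m - (c - 1ℤ) * m′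
    eq₂ = solve-∀

  -- The total of the factor of length m + 1 at `k` lies strictly between -N and N.
  Fits : ∀ {n} → Slope n → ℤ → ℕ → Set
  Fits σ k m = + C k (suc m) * N < + suc m * p + N × + suc m * p < + C k (suc m) * N + N
    where open Slope σ

  -- The slope is p/N = r + 1/M with M so large that m/M lies strictly between 0 and
  -- 1/↧ r for 0 < m ≤ n + 1.
  slope-of-bound : ∀ n r → 0ℤ ≤ ↥ r → Admissible r →
    Σ (Slope n) λ σ → ∀ k m → m ℕ.< n → (+ C k (suc m) - 1ℤ) * ↧ r ≤ ↥ r * + suc m → Fits σ k m
  slope-of-bound n r 0≤a adm = record { N = N ; p = p ; 0<p = 0<p ; p<N = p<N ; generic = generic } , fits
    where
    open Admissible adm
    a = ↥ r
    b = ↧ r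
    M = + suc n * b + 1ℤ
    N = b * M
    p = a * M + b
    nonNeg-* : ∀ {i j} → 0ℤ ≤ i → 0ℤ ≤ j → 0ℤ ≤ i * j
    nonNeg-* {i} {j} 0≤i 0≤j = ℤₚ.*-monoʳ-≤-nonNeg j ⦃ ℤ.nonNegative 0≤j ⦄ 0≤i
    0<b : 0ℤ < b
    0<b = +<+ (s≤s z≤n)
    0≤b = ℤₚ.<⇒≤ 0<b
    0≤M : 0ℤ ≤ M
    0≤M = +-nonNeg (nonNeg-* {+ suc n} (+≤+ z≤n) 0≤b) (+≤+ z≤n)
    mb<M : ∀ m → m ℕ.≤ suc n → + m * b < M
    mb<M m m≤n = ℤₚ.≤-<-trans (ℤₚ.*-monoʳ-≤-nonNeg b (+≤+ m≤n)) (move-< {0ℤ} {1ℤ} (+<+ (s≤s z≤n)) (eq (+ suc n * b)))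
      where
      eq : ∀ t → 1ℤ - 0ℤ ≡ (t + 1ℤ) - t
      eq = solve-∀
    -- A strict inequality of integers leaves a slack of at least 1, which after multiplication by M
    -- outweighs m b < M.
    suc-gap : ∀ {i j} → i < j → 0ℤ ≤ j - (1ℤ + i)
    suc-gap i<j = ℤₚ.i≤j⇒0≤j-i (ℤₚ.i<j⇒suc[i]≤j i<j)
    pos-diff : ∀ {i j} → i < j → 0ℤ < j - i
    pos-diff {i} {j} i<j = move-< i<j (eq i j)
      where
      eq : ∀ i j → j - i ≡ (j - i) - 0ℤ
      eq = solve-∀
    0<mb : ∀ m → 0ℤ < + suc m * b
    0<mb m = +<+ (s≤s z≤n)
    0<p : 0ℤ < p
    0<p = nonNeg+pos (nonNeg-* 0≤a 0≤M) 0<b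
    p<N : p < N
    p<N = move-< (nonNeg+pos (nonNeg-* (suc-gap below-1) 0≤M) (pos-diff (mb<M 1 (s≤s z≤n)))) (eq a b M)
      where
      eq : ∀ a b M → ((b - (1ℤ + a)) * M + (M - 1ℤ * b)) - 0ℤ ≡ b * M - (a * M + b)
      eq = solve-∀
    fits : ∀ k m → m ℕ.< n → (+ C k (suc m) - 1ℤ) * b ≤ a * + suc m →
      + C k (suc m) * N < + suc m * p + N × + suc m * p < + C k (suc m) * N + N
    fits k m m<n le =
      move-< (nonNeg+pos (nonNeg-* (ℤₚ.i≤j⇒0≤j-i le) 0≤M) (0<mb m)) (eq₁ a b M (+ C k (suc m)) (+ suc m)) ,
      move-< (nonNeg+pos (nonNeg-* (suc-gap (below-upper k m)) 0≤M) (pos-diff (mb<M (suc m) (ℕₚ.m≤n⇒m≤1+n m<n))))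
        (eq₂ a b M (+ C k (suc m)) (+ suc m))
      where
      eq₁ : ∀ a b M c m → ((a * m - (c - 1ℤ) * b) * M + m * b) - 0ℤ ≡ (m * (a * M + b) + b * M) - c * (b * M)
      eq₁ = solve-∀
      eq₂ : ∀ a b M c m → (((1ℤ + c) * b - (1ℤ + a * m)) * M + (M - m * b)) - 0ℤ ≡ (c * (b * M) + b * M) - m * (a * M + b)
      eq₂ = solve-∀
    -- For a length m with 0 < m ≤ n, c N = m p would give (c b - m a)M = m b, but 0 < m b < M.
    generic : ∀ c m → m ℕ.< n → c * N ≢ + suc m * p
    generic c m m<n e with 0ℤ ℤ.<? (c * b - + suc m * a)
    ... | yes 0<d = ℤₚ.<-irrefl (sym (trans (eq a b M c (+ suc m)) (trans (cong (_- + suc m * p) e) (ℤₚ.+-inverseʳ (+ suc m * p)))))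
        (nonNeg+pos (nonNeg-* (suc-gap 0<d) 0≤M) (pos-diff (mb<M (suc m) (ℕₚ.m≤n⇒m≤1+n m<n))))
      where
      eq : ∀ a b M c m → (c * b - m * a - (1ℤ + 0ℤ)) * M + (M - m * b) ≡ c * (b * M) - m * (a * M + b)
      eq = solve-∀
    ... | no 0≮d = ℤₚ.<-irrefl (sym (trans (eq a b M c (+ suc m)) (trans (cong (λ t → + suc m * p - t) e) (ℤₚ.+-inverseʳ (+ suc m * p)))))
        (nonNeg+pos (nonNeg-* (ℤₚ.i≤j⇒0≤j-i (ℤₚ.≮⇒≥ 0≮d)) 0≤M) (0<mb m))
      where
      eq : ∀ a b M c m → (0ℤ - (c * b - m * a)) * M + m * b ≡ m * (a * M + b) - c * (b * M)
      eq = solve-∀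

  -- The default 0 of the maximum keeps it nonnegative and is itself admissible.
  best-bound : ∀ (bounds : List ℚᵘ) → All Admissible bounds →
    ∃ λ r → 0ℤ ≤ ↥ r × Admissible r × All (ℚ._≤ r) bounds
  best-bound bounds adm =
    max 0/1 bounds , nonNeg (⊥≤max 0/1 bounds) , argmax-all id 0-admissible adm , xs≤max 0/1 bounds
    where
    0/1 = mkℚᵘ 0ℤ 0
    nonNeg : ∀ {r} → 0/1 ℚ.≤ r → 0ℤ ≤ ↥ r
    nonNeg {r} (*≤* le) = subst₂ _≤_ (ℤₚ.*-zeroˡ (↧ r)) (ℤₚ.*-identityʳ (↥ r)) le

  -- Finitely many positions and lengths give finitely many lower bounds; the slope is taken just
  -- above the largest.
  slope-of-positions : ∀ n positions → Σ (Slope n) λ σ → ∀ {k m} → k ∈ positions → m ℕ.< n → Fits σ k m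
  slope-of-positions n positions = from-bound (best-bound bounds (All.tabulate admissible))
    where
    bounds = cartesianProductWith lower positions (upTo n)
    admissible : ∀ {x} → x ∈ bounds → Admissible x
    admissible x∈ with ∈-cartesianProductWith⁻ lower positions (upTo n) x∈
    ... | k , m , _ , _ , refl = lower-admissible k m
    from-bound : (∃ λ r → 0ℤ ≤ ↥ r × Admissible r × All (ℚ._≤ r) bounds) →
      Σ (Slope n) λ σ → ∀ {k m} → k ∈ positions → m ℕ.< n → Fits σ k m
    from-bound (r , 0≤r , adm , bound) = from-slope (slope-of-bound n r 0≤r adm)
      where
      from-slope : (Σ (Slope n) λ σ → ∀ k m → m ℕ.< n → (+ C k (suc m) - 1ℤ) * ↧ r ≤ ↥ r * + suc m → Fits σ k m) →
        Σ (Slope n) λ σ → ∀ {k m} → k ∈ positions → m ℕ.< n → Fits σ k m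
      from-slope (σ , fits) = σ , λ {k} {m} k∈ m<n →
        fits k m m<n (ℚₚ.drop-*≤* (All.lookup bound (∈-cartesianProductWith⁺ lower k∈ (∈-upTo⁺ m<n))))

  module _ {n} (σ : Slope n) where
    open Slope σ
    open Heights σ

    private
      diff : ∀ N p c c′ j m → (c + c′) * N - (j + m) * p ≡ (c * N - j * p) + (c′ * N - m * p)
      diff = solve-∀

      left : ∀ h N c t → (c + N) - t ≡ (h + (c - t) + N) - h
      left = solve-∀

      right : ∀ h N c t → (t + N) - c ≡ (h + N) - (h + (c - t))
      right = solve-∀

    -- Two heights differ by the total of the factor between them, which is again a factor of `s`.
    factor-balanced : ∀ k → (∀ i m → i ℕ.< n → m ℕ.< n → Fits σ (k + + i) m) → SlopeBalanced (factorAt s k n)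
    factor-balanced k fits i j i≤ j≤ = go (ℕₚ.<-cmp i j)
      where
      x = factorAt s k n
      height≡ : ∀ i → i ℕ.≤ n → height x i ≡ + C k i * N - + i * p
      height≡ i i≤n = cong (λ w → + count 𝟏 w * N - + i * p) (take-factorAt s k i≤n)
      i≤n = subst (i ℕ.≤_) (length-factorAt s k n) i≤
      j≤n = subst (j ℕ.≤_) (length-factorAt s k n) j≤
      difference : ∀ {i j} → i ℕ.< j → j ℕ.≤ n → ∃ λ m → m ℕ.< n ×
        height x j ≡ height x i + (+ C (k + + i) (suc m) * N - + suc m * p)
      difference {i} {j} i<j j≤n = m , ℕₚ.<-≤-trans (ℕₚ.∸-monoʳ-< {j} {suc i} {0} (s≤s z≤n) i<j) j≤n ,
        trans (height≡ j j≤n)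
        (trans (cong (λ t → + C k t * N - + t * p) j≡)
        (trans (cong (λ c → + c * N - (+ i + + suc m) * p) (C-+ k i (suc m)))
        (trans (diff N p (+ C k i) (+ C (k + + i) (suc m)) (+ i) (+ suc m))
        (cong (_+ (+ C (k + + i) (suc m) * N - + suc m * p)) (sym (height≡ i (ℕₚ.≤-trans (ℕₚ.<⇒≤ i<j) j≤n)))))))
        where
        m = j ℕ.∸ suc i
        j≡ : j ≡ i ℕ.+ suc m
        j≡ = trans (sym (ℕₚ.m+[n∸m]≡n i<j)) (sym (ℕₚ.+-suc i m))
      go : Tri (i ℕ.< j) (i ≡ j) (j ℕ.< i) → height x i < height x j + N
      go (tri< i<j _ _) with difference i<j j≤n
      ... | m , m<n , e = subst (λ h → height x i < h + N) (sym e)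
            (move-< (proj₂ (fits i m (ℕₚ.<-≤-trans i<j j≤n) m<n)) (left (height x i) N (+ C (k + + i) (suc m) * N) (+ suc m * p)))
      go (tri≈ _ refl _) = subst (_< height x i + N) (ℤₚ.+-identityʳ (height x i)) (ℤₚ.+-monoʳ-< (height x i) 0<N)
      go (tri> _ _ j<i) with difference j<i i≤n
      ... | m , m<n , e = subst (λ h → h < height x j + N) (sym e)
            (move-< (proj₁ (fits j m (ℕₚ.<-≤-trans j<i i≤n) m<n)) (right (height x j) N (+ C (k + + j) (suc m) * N) (+ suc m * p)))

  -- The starting positions inside both factors are pooled, so that one slope serves both.
  factors-balanced : ∀ n k l → Σ (Slope n) λ σ → let open Heights σ in
    SlopeBalanced (factorAt s k n) × SlopeBalanced (factorAt s l n)
  factors-balanced n k l = from-slope (slope-of-positions n (shifts k ++ shifts l))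
    where
    shifts : ℤ → List ℤ
    shifts k = map (λ i → k + + i) (upTo n)
    from-slope : (Σ (Slope n) λ σ → ∀ {i m} → i ∈ shifts k ++ shifts l → m ℕ.< n → Fits σ i m) →
      Σ (Slope n) λ σ → let open Heights σ in SlopeBalanced (factorAt s k n) × SlopeBalanced (factorAt s l n)
    from-slope (σ , fits) = σ ,
      factor-balanced σ k (λ i m i<n m<n → fits (∈-++⁺ˡ (∈-map⁺ (λ i → k + + i) (∈-upTo⁺ i<n))) m<n) ,
      factor-balanced σ l (λ i m i<n m<n → fits (∈-++⁺ʳ (shifts k) (∈-map⁺ (λ i → l + + i) (∈-upTo⁺ i<n))) m<n)

-- Comparing factors of a balanced sequence

prefix-balanced : ∀ {n} (σ : Slope n) x y → Heights.SlopeBalanced σ (x ++ y) → Heights.SlopeBalanced σ x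
prefix-balanced σ x y sb i j i≤ j≤ =
  subst₂ (λ h h′ → h < h′ + N)
    (height-cong (x ++ y) x i (ones-++ x y i i≤)) (height-cong (x ++ y) x j (ones-++ x y j j≤))
    (sb i j (weaken i≤) (weaken j≤))
  where
  open Slope σ
  open Heights σ
  weaken : ∀ {i} → i ℕ.≤ length x → i ℕ.≤ length (x ++ y)
  weaken {i} i≤ = subst (i ℕ.≤_) (sym (length-++ x)) (ℕₚ.m≤n⇒m≤n+o (length y) i≤)

-- Covers an empty shorter word, which `shorter⇒⊰` excludes.
entry-[] : ∀ a w → entry [] ⊰ entry (a ∷ w)
entry-[] a w = ⊰-of-diff (λ k → sym (ℤₚ.+-identityˡ _)) (proj₁ (act-pos₂ a (column-nonNeg w) (column-pos₂ w)))

module _ (s : Seq) (balanced : Balanced s) where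

  lex-increasing : ∀ n k l → factorAt s k n <lex factorAt s l n → entry (factorAt s k n) ⊰ entry (factorAt s l n)
  lex-increasing n k l lt =
    let σ , sbk , sbl = factors-balanced s balanced n k l
    in lex⇒⊰ σ lt (trans (length-factorAt s k n) (sym (length-factorAt s l n)))
         (ℕₚ.≤-reflexive (length-factorAt s k n)) sbk sbl

  -- The shorter factor is lengthened by one letter in `s` to obtain a common slope and then cut
  -- back; letters beyond the first extra one are added by `column-prefix`.
  length-increasing : ∀ m m′ k l → entry (factorAt s k m) ⊰ entry (factorAt s l (suc m ℕ.+ m′))
  length-increasing zero    m′ k l = entry-[] (s l) (factorAt s (l + + 1) m′)
  length-increasing (suc m) m′ k l =
    let σ , sbk , sbl = factors-balanced s balanced (suc (suc m)) k l
        sbk′ = subst (Heights.SlopeBalanced σ)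
                 (trans (cong (factorAt s k) (ℕₚ.+-comm 1 (suc m))) (factorAt-+ s k (suc m) 1)) sbk
    in ⊰-≼-trans
         (shorter⇒⊰ σ (factorAt s k (suc m)) (factorAt s l (suc (suc m)))
           (length-factorAt s k (suc m)) (length-factorAt s l (suc (suc m))) ℕₚ.≤-refl
           (prefix-balanced σ (factorAt s k (suc m)) _ sbk′) sbl)
         (subst (λ w → entry (factorAt s l (suc (suc m))) ≼ entry w) (sym (factorAt-+ s l (suc (suc m)) m′))
           (proj₁ (column-prefix (factorAt s l (suc (suc m))) _)))

theoremA : (s : Seq) → Balanced s → (u v : Word) → u ∈L s → v ∈L s →
    u <radix v → m12 (μq u) ≺ m12 (μq v)
theoremA s balanced u v (k , u≡) (l , v≡) (inj₁ shorter) = ≺-of-⊰ u v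
  (subst₂ (λ x y → entry x ⊰ entry y) (sym u≡)
    (trans (cong (factorAt s l) (ℕₚ.m+[n∸m]≡n shorter)) (sym v≡))
    (length-increasing s balanced (length u) (length v ℕ.∸ suc (length u)) k l))
theoremA s balanced u v (k , u≡) (l , v≡) (inj₂ (|u|≡|v| , u<v)) = ≺-of-⊰ u v
  (subst₂ (λ x y → entry x ⊰ entry y) (sym u≡) (sym v≡′)
    (lex-increasing s balanced (length u) k l (subst₂ _<lex_ u≡ v≡′ u<v)))
  where
  v≡′ : v ≡ factorAt s l (length u)
  v≡′ = trans v≡ (cong (factorAt s l) (sym |u|≡|v|))
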